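{- Let $\mathcal H$ be a cluster of graphs with anchor $H$, and suppose that $\mathrm{gen}(H)<\mathrm{gen}(\bigcup\mathcal H)$. Then there is a subcollection $\overline{\mathcal H}\subseteq\mathcal H$ with $H\in\overline{\mathcal H}$ and $|\overline{\mathcal H}|\le 5$ such that $\mathrm{gen}(H)<\mathrm{gen}(\bigcup\overline{\mathcal H})$.
   Context: All surfaces are compact and orientable; $\Sigma_g$ denotes the one of genus $g$. A cluster of graphs is a finite collection $\mathcal H$ of pairwise edge-disjoint connected graphs simultaneously embedded in one surface, such that some $H\in\mathcal H$ (an anchor) shares at least one vertex with every graph in $\mathcal H$. For a subfamily $\mathcal F$, $\bigcup\mathcal F$ is the embedded graph that is the union of its members. The rotation at a vertex of an embedded graph is the clockwise cyclic order of its incident edges; two embedded graphs are isomorphic if there is an isomorphism of the underlying abstract graphs mapping rotations to rotations. The genus $\mathrm{gen}(G)$ of an embedded graph $G$ is the least $g$ such that $G$ is isomorphic (as an embedded graph) to a graph embedded in $\Sigma_g$; for connected $G$ with vertex set $V$, edge set $E$ and set of facial walks $\mathcal W$, $\mathrm{gen}(G)=\tfrac12(2-|V|+|E|-|\mathcal W|)$. -}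

module Defs where

open import Data.Bool using (Bool; true; false; not; if_then_else_; _∧_; T)
open import Data.Nat using (ℕ; zero; suc; _+_; _*_; _∸_; _≤ᵇ_; _≡ᵇ_; _/_)
open import Data.Fin using (Fin; toℕ)
open import Data.Fin.Subset using (Subset; ⊤; ⁅_⁆)
open import Data.List using (List; allFin; upTo; filter; length; concatMap; _∷_; [])
open import Data.Bool.ListAction using (all; any)
open import Relation.Nullary.Decidable using (T?)
open import Data.Vec using (lookup)
open import Data.Product using (_×_; _,_; proj₁; proj₂; ∃-syntax)
open import Relation.Binary.PropositionalEquality using (_≡_)

iter : {A : Set} → (A → A) → ℕ → A → A
iter f zero    x = x
iter f (suc n) x = f (iter f n x)

-- Half-edges (darts) of a graph with m edges: edge e has the two darts (e , false), (e , true).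
Dart : ℕ → Set
Dart m = Fin m × Bool

flipD : {m : ℕ} → Dart m → Dart m
flipD (e , b) = (e , not b)

-- An embedded graph on an orientable surface, given by its rotation system
-- (multigraph: loops and parallel edges allowed, isolated vertices allowed).
record EmbeddedGraph : Set where
  field
    nV nE : ℕ
    end     : Dart nE → Fin nV          -- vertex to which a half-edge is attached
    rot     : Dart nE → Dart nE         -- clockwise successor of a half-edge at its vertex
    rot⁻    : Dart nE → Dart nE
    rot-inv₁ : ∀ d → rot⁻ (rot d) ≡ d
    rot-inv₂ : ∀ d → rot (rot⁻ d) ≡ d
    rot-end  : ∀ d → end (rot d) ≡ end d
    rot-cyclic : ∀ d d' → end d ≡ end d' → ∃[ i ] iter rot i d ≡ d'

count : {n : ℕ} → (Fin n → Bool) → ℕ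
count {n} p = length (filter (λ i → T? (p i)) (allFin n))

allDarts : (m : ℕ) → List (Dart m)
allDarts m = concatMap (λ e → (e , false) ∷ (e , true) ∷ []) (allFin m)

rank : {m : ℕ} → Dart m → ℕ
rank (e , b) = 2 * toℕ e + (if b then 1 else 0)

nextIn : {m : ℕ} → (Dart m → Bool) → (Dart m → Dart m) → ℕ → Dart m → Dart m
nextIn P r zero    d = d
nextIn P r (suc n) d = if P (r d) then r d else nextIn P r n (r d)

-- A cluster-like family of k graphs, all embedded simultaneously (as subgraphs of the
-- embedded graph G, whose edges are partitioned among the members).
record Family (G : EmbeddedGraph) (k : ℕ) : Set where
  open EmbeddedGraph G
  field
    edgeOf : Fin nE → Fin k            -- member containing each edge (edge-disjointness)
    vert   : Fin k → Fin nV → Bool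
    end-in : ∀ (d : Dart nE) → vert (edgeOf (proj₁ d)) (end d) ≡ true

module _ (G : EmbeddedGraph) {k : ℕ} (F : Family G k) where
  open EmbeddedGraph G
  open Family F

  data Reach (i : Fin k) : Fin nV → Fin nV → Set where
    here : ∀ {u} → Reach i u u
    step : ∀ {u v} (d : Dart nE) → edgeOf (proj₁ d) ≡ i → end d ≡ u
         → Reach i (end (flipD d)) v → Reach i u v

  Connected : Fin k → Set
  Connected i = ∀ u v → vert i u ≡ true → vert i v ≡ true → Reach i u v

  IsCluster : Fin k → Set
  IsCluster a = (∀ i → Connected i)
              × (∀ i → ∃[ v ] (vert a v ≡ true × vert i v ≡ true))

  module Union (S : Subset k) where
    inE : Fin nE → Bool
    inE e = lookup S (edgeOf e)

    inD : Dart nE → Bool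
    inD d = inE (proj₁ d)

    inV : Fin nV → Bool
    inV v = any (λ i → lookup S i ∧ vert i v) (allFin k)

    rotS : Dart nE → Dart nE
    rotS = nextIn inD rot (2 * nE)

    -- face-tracing permutation of the induced rotation system
    φ : Dart nE → Dart nE
    φ d = rotS (flipD d)

    -- a dart is the representative of its facial walk if it has minimal rank in its φ-orbit
    isRep : Dart nE → Bool
    isRep d = inD d ∧ all (λ j → rank d ≤ᵇ rank (iter φ j d)) (upTo (suc (2 * nE)))

    -- vertices of ⋃S with no incident half-edge of ⋃S (each has one trivial facial walk)
    isolated : Fin nV → Bool
    isolated v = inV v ∧ not (any (λ d → inD d ∧ (toℕ (end d) ≡ᵇ toℕ v)) (allDarts nE))

    #V #E #F : ℕ
    #V = count inV
    #E = count inE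
    #F = length (filter (λ d → T? (isRep d)) (allDarts nE)) + count isolated

    -- gen = (2 - |V| + |E| - |W|) / 2  (for connected graphs this is a nonnegative integer)
    genus : ℕ
    genus = ((2 + #E) ∸ (#V + #F)) / 2

  gen : Subset k → ℕ
  gen S = Union.genus S

module Submission where

-- Genus is controlled through homology.  Building a connected subgraph up edge by edge, the genus
-- grows by one exactly when a new edge joins two different faces, and such an edge carries an
-- 𝔽₂-valued 1-form (1 on that edge, 0 before it, extended over the later edges) that is closed, i.e.
-- vanishes on all face boundaries, but has no primitive vanishing on the earlier vertices.  If
-- gen H < gen (⋃ 𝓗), there is thus a closed form x on ⋃ 𝓗 that is zero on H and has no primitive
-- vanishing on H.  Suppose that no family of H and four other members raises the genus.  Then:
--  * each face of S = H ∪ P ∪ Q stays a union of faces after adding two more members, and since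
--    every member is connected and meets H these decompositions glue to one in ⋃ 𝓗, so the
--    restriction of x to S is closed;
--  * as gen S = gen H, x then has on S a unique primitive vanishing on H, and the primitives on the
--    various S = H ∪ P ∪ Q glue to a primitive of x on ⋃ 𝓗, which is a contradiction.

open import Defs
open import Data.Nat using (ℕ; _<_; _≤_)
open import Data.Fin using (Fin)
open import Data.Fin.Subset using (Subset; ⊤; ⁅_⁆; _∈_; ∣_∣)
open import Data.Product using (_×_; ∃-syntax)
open import Algebra.Bundles using (CommutativeRing; CommutativeMonoid)
open import Data.Bool using (Bool; true; false; not; _∧_; _∨_; _xor_; T; if_then_else_)
open import Data.Bool.ListAction using (all; any)
import Data.Bool.Properties as Boolₚ
open import Data.Empty using (⊥; ⊥-elim)
open import Data.Fin using (zero; suc; toℕ; fromℕ<; splitAt; join)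
open import Data.Fin.Permutation using (Permutation; permutation)
import Data.Fin.Properties as Finₚ
open import Data.Fin.Subset using (_∪_; inside; outside)
open import Data.Fin.Subset.Properties using (x∈⁅x⁆; ∣⁅x⁆∣≡1; x∈p∪q⁺; ∈⊤)
open import Data.List using (List; []; _∷_; length; _++_; filter; allFin; map; upTo)
open import Data.List.Membership.Propositional using (find; lose) renaming (_∈_ to _∈ₗ_)
open import Data.List.Membership.Propositional.Properties
  using (∈-∃++; ∈-filter⁺; ∈-filter⁻; ∈-allFin; ∈-concatMap⁺; ∈-upTo⁺; ∈-map⁺; ∈-++⁺ˡ; ∈-++⁺ʳ)
import Data.List.Properties as Listₚ
open import Data.List.Relation.Binary.Permutation.Propositional as ↭ using (_↭_)
open import Data.List.Relation.Binary.Permutation.Propositional.Properties as ↭ₚ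
  using (↭-length; ∈-resp-↭; All-resp-↭)
open import Data.List.Relation.Unary.All as All using (All; []; _∷_)
import Data.List.Relation.Unary.All.Properties as Allₚ
open import Data.List.Relation.Unary.AllPairs as AllPairs using (AllPairs; []; _∷_)
import Data.List.Relation.Unary.AllPairs.Properties as AllPairsₚ
open import Data.List.Relation.Unary.Any using (here; there)
import Data.List.Relation.Unary.Any.Properties as Anyₚ
open import Data.List.Relation.Unary.Unique.Propositional using (Unique)
import Data.List.Relation.Unary.Unique.Propositional.Properties as Uniqueₚ
open import Data.Nat using (zero; suc; _+_; _*_; _∸_; _/_; _≤ᵇ_; _≡ᵇ_; _≤?_; _<?_; z≤n; s≤s; s≤s⁻¹)
open import Data.Nat.DivMod using (m*n/n≡m)
open import Data.Nat.Induction using (<-rec)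
import Data.Nat.Properties as ℕₚ
open import Data.Nat.Solver using (module +-*-Solver)
open import Data.Product using (_,_; proj₁; proj₂; map₂)
open import Data.Sum as Sum using (_⊎_; inj₁; inj₂; [_,_]′)
import Data.Sum.Properties as Sumₚ
open import Data.Vec using (lookup; []; _∷_)
open import Data.Vec.Properties using ([]=⇒lookup; lookup⇒[]=)
open import Function using (_∘_; id; const; Equivalence; mk⇔)
open import Relation.Nullary using (¬_; Dec; yes; no; does)
open import Relation.Nullary.Decidable
  using (map′; T?; dec-true; dec-false; does-⇔; toSum; _×-dec_; _⊎-dec_)
open import Relation.Binary.PropositionalEquality
open import Algebra.Properties.CommutativeMonoid.Sum
  (CommutativeRing.+-commutativeMonoid Boolₚ.xor-∧-commutativeRing)
  using (sum; sum-cong-≗; ∑-distrib-+; sum-permute)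
open import Algebra.Properties.CommutativeSemigroup
  (CommutativeMonoid.commutativeSemigroup (CommutativeRing.+-commutativeMonoid Boolₚ.xor-∧-commutativeRing))
  using () renaming (interchange to xor-medial)

-- Genus is a global count, while stability is known only for a few members at a time, so it has to
-- be turned into data that can be compared locally. Two kinds of data serve: primitives that vanish
-- on the anchor, and Boolean colourings of darts that are constant on faces. Both propagate along a
-- connected member from its common vertex with the anchor, hence are unique on that member. Two
-- members may still meet away from the anchor, and agreement there is certified only by a family
-- that contains both. Each member is compared with one chosen member at the given vertex, so pairs
-- suffice, and every gluing costs two members besides those already present. Two gluings are
-- nested. Primitives are glued over families `H ∪ P ∪ Q`. They exist there only if the restricted
-- form is closed, and this is not automatic: the boundary of a face of `S` need not bound in the
-- larger surface. So colourings of the faces of `S` are extended over everything, by a second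
-- gluing over pairs added to `S`. This gives 1 + 2 + 2 = 5.

allPairs-refine : {A : Set} {P : A → Set} {Q R : A → A → Set} {xs : List A}
  → (∀ {x y} → P x → P y → Q x y → R x y) → All P xs → AllPairs Q xs → AllPairs R xs
allPairs-refine f []       []         = []
allPairs-refine f (p ∷ ps) (qs ∷ qss) =
  All.zipWith (λ (py , q) → f p py q) (ps , qs) ∷ allPairs-refine f ps qss

pull : {A : Set} {x : A} {xs : List A} → x ∈ₗ xs → ∃[ ys ] xs ↭ x ∷ ys
pull i with ∈-∃++ i
... | us , vs , refl = us ++ vs , ↭ₚ.shift _ us vs

-- Systems of representatives of an equivalence relation, as lists.

Separated : {A : Set} → (A → A → Set) → List A → Set
Separated R = AllPairs (λ x y → ¬ R x y)

record Transversal {A : Set} (R : A → A → Set) (P : A → Set) (xs : List A) : Set where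
  field
    sound    : All P xs
    separate : Separated R xs
    complete : ∀ {y} → P y → ∃[ x ] (x ∈ₗ xs × R x y)
open Transversal

module Transversals {A : Set} (R : A → A → Set) (R-refl : ∀ {x} → R x x)
  (R-sym : ∀ {x y} → R x y → R y x) (R-trans : ∀ {x y z} → R x y → R y z → R x z) where

  separate-resp-↭ : ∀ {xs ys} → xs ↭ ys → Separated R xs → Separated R ys
  separate-resp-↭ ↭.refl           ns       = ns
  separate-resp-↭ (↭.prep x p)     (n ∷ ns) = All-resp-↭ p n ∷ separate-resp-↭ p ns
  separate-resp-↭ (↭.swap x y p) ((xy ∷ n) ∷ m ∷ ns) =
    ((λ r → xy (R-sym r)) ∷ All-resp-↭ p m) ∷ All-resp-↭ p n ∷ separate-resp-↭ p ns
  separate-resp-↭ (↭.trans p q)  ns       = separate-resp-↭ q (separate-resp-↭ p ns)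

  -- A single `y` related to two entries of `xs` would relate them to each other, so the `y` used
  -- for the head can be deleted before the induction continues.
  separated-length : ∀ {xs ys} → Separated R xs → (∀ {x} → x ∈ₗ xs → ∃[ y ] (y ∈ₗ ys × R y x))
    → length xs ≤ length ys
  separated-length []        cov = z≤n
  separated-length {x ∷ xs} (n ∷ ns) cov with cov (here refl)
  ... | y , y∈ys , yx with pull y∈ys
  ... | ys' , perm rewrite ↭-length perm = s≤s (separated-length ns cov')
    where
    cov' : ∀ {z} → z ∈ₗ xs → ∃[ w ] (w ∈ₗ ys' × R w z)
    cov' z∈xs with cov (there z∈xs)
    ... | w , w∈ys , wz with ∈-resp-↭ perm w∈ys
    ... | here refl = ⊥-elim (All.lookup n z∈xs (R-trans (R-sym yx) wz))
    ... | there w∈  = w , w∈ , wz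

  length-unique : ∀ {P xs ys} → Transversal R P xs → Transversal R P ys → length xs ≡ length ys
  length-unique s t = ℕₚ.≤-antisym (half s t) (half t s)
    where
    half : ∀ {P xs ys} → Transversal R P xs → Transversal R P ys → length xs ≤ length ys
    half s t = separated-length (separate s) (λ i → complete t (All.lookup (sound s) i))

  -- Exchanges the representative of the class of `a` for `a` itself, so that the transposition
  -- lemmas find the dart in question at the head of the list.
  choose : ∀ {P xs a} → Transversal R P xs → P a
    → ∃[ ys ] (length xs ≡ suc (length ys) × Transversal R P (a ∷ ys))
  choose {a = a} t pa with complete t pa
  ... | x , x∈xs , xa with pull x∈xs
  ... | ys , perm with separate-resp-↭ perm (separate t) | All-resp-↭ perm (sound t)
  ... | n ∷ ns | _ ∷ ps = ys , ↭-length perm , record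
    { sound = pa ∷ ps
    ; separate = All.map (λ nxz az → nxz (R-trans xa az)) n ∷ ns
    ; complete = λ py → let z , z∈ , zy = complete t py in conv zy (∈-resp-↭ perm z∈) }
    where
    conv : ∀ {z y} → R z y → z ∈ₗ x ∷ ys → ∃[ w ] (w ∈ₗ a ∷ ys × R w y)
    conv zy (here refl) = a , here refl , R-trans (R-sym xa) zy
    conv zy (there i)   = _ , there i , zy

iter-+ : {A : Set} (h : A → A) (m n : ℕ) (x : A) → iter h (m + n) x ≡ iter h m (iter h n x)
iter-+ h zero    n x = refl
iter-+ h (suc m) n x = cong h (iter-+ h m n x)

iter-suc : {A : Set} (h : A → A) (n : ℕ) (x : A) → iter h n (h x) ≡ h (iter h n x)
iter-suc h zero    x = refl
iter-suc h (suc n) x = cong h (iter-suc h n x)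

-- Orbits of a self-map of a finite set

Orb : {A : Set} → (A → A) → A → A → Set
Orb h x y = ∃[ i ] iter h i x ≡ y

module _ {A : Set} {h : A → A} where

  orb-refl : ∀ {x} → Orb h x x
  orb-refl = 0 , refl

  orb-step : ∀ {x} → Orb h x (h x)
  orb-step = 1 , refl

  orb-trans : ∀ {x y z} → Orb h x y → Orb h y z → Orb h x z
  orb-trans {x} (i , refl) (j , refl) = j + i , iter-+ h j i x

  orb-preserves : (P : A → Set) → (∀ {x} → P x → P (h x)) → ∀ {x y} → Orb h x y → P x → P y
  orb-preserves P next (zero  , refl) p = p
  orb-preserves P next (suc i , refl) p = next (orb-preserves P next (i , refl) p)

  orb-const : {B : Set} (f : A → B) → (∀ x → f (h x) ≡ f x) → ∀ {x y} → Orb h x y → f x ≡ f y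
  orb-const f inv {x} o = orb-preserves (λ y → f x ≡ f y) (λ p → trans p (sym (inv _))) o refl

module Finite {A : Set} {N : ℕ} (enc : A → Fin N) (enc-inj : ∀ {x y} → enc x ≡ enc y → x ≡ y) where

  _≟_ : (x y : A) → Dec (x ≡ y)
  x ≟ y = map′ enc-inj (cong enc) (enc x Finₚ.≟ enc y)

  module _ (h : A → A) where

    repetition : ∀ x → ∃[ i ] ∃[ j ] (i < j × j ≤ N × iter h i x ≡ iter h j x)
    repetition x with Finₚ.pigeonhole (ℕₚ.n<1+n N) (λ i → enc (iter h (toℕ i) x))
    ... | i , j , i<j , eq = toℕ i , toℕ j , i<j , s≤s⁻¹ (Finₚ.toℕ<n j) , enc-inj eq

    shorten : ∀ x j → ∃[ j' ] (j' ≤ N × iter h j' x ≡ iter h j x)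
    shorten x = <-rec _ go
      where
      go : ∀ j → (∀ {k} → k < j → ∃[ j' ] (j' ≤ N × iter h j' x ≡ iter h k x))
        → ∃[ j' ] (j' ≤ N × iter h j' x ≡ iter h j x)
      go j rec with j ≤? N
      ... | yes j≤N = j , j≤N , refl
      ... | no  j≰N with repetition x
      ... | p , q , p<q , q≤N , eq = map₂ (map₂ (λ e → trans e shorter)) (rec less)
        where
        q≤j : q ≤ j
        q≤j = ℕₚ.≤-trans q≤N (ℕₚ.<⇒≤ (ℕₚ.≰⇒> j≰N))
        less : (j ∸ q) + p < j
        less = subst ((j ∸ q) + p <_) (ℕₚ.m∸n+n≡m q≤j) (ℕₚ.+-monoʳ-< (j ∸ q) p<q)
        shorter : iter h ((j ∸ q) + p) x ≡ iter h j x
        shorter = begin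
          iter h ((j ∸ q) + p) x     ≡⟨ iter-+ h (j ∸ q) p x ⟩
          iter h (j ∸ q) (iter h p x) ≡⟨ cong (iter h (j ∸ q)) eq ⟩
          iter h (j ∸ q) (iter h q x) ≡⟨ iter-+ h (j ∸ q) q x ⟨
          iter h ((j ∸ q) + q) x     ≡⟨ cong (λ k → iter h k x) (ℕₚ.m∸n+n≡m q≤j) ⟩
          iter h j x ∎
          where open ≡-Reasoning

    orb? : ∀ x y → Dec (Orb h x y)
    orb? x y = map′ (λ (i , e) → toℕ i , e) bounded (Finₚ.any? (λ i → iter h (toℕ {suc N} i) x ≟ y))
      where
      bounded : Orb h x y → ∃[ i ] iter h (toℕ {suc N} i) x ≡ y
      bounded (j , refl) with shorten x j
      ... | k , k≤N , e = fromℕ< (s≤s k≤N) , trans (cong (λ i → iter h i x) (Finₚ.toℕ-fromℕ< (s≤s k≤N))) e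

  module _ {h : A → A} (h-inj : ∀ {x y} → h x ≡ h y → x ≡ y) where

    cancel : ∀ i r {x} → iter h i x ≡ iter h (i + r) x → iter h r x ≡ x
    cancel zero    r e = sym e
    cancel (suc i) r e = cancel i r (h-inj e)

    -- Pigeonhole gives a repetition, and injectivity cancels it back to the start. The bound on `p`
    -- is needed as well as its existence: the search in `nextIn` has limited fuel.
    period : ∀ x → ∃[ p ] (p < N × iter h p (h x) ≡ x)
    period x with repetition h x
    ... | i , j , i<j , j≤N , eq with ℕₚ.m≤n⇒∃[o]m+o≡n i<j
    ... | r , refl = r , ℕₚ.≤-trans (s≤s (ℕₚ.m≤n+m r i)) j≤N
        , trans (iter-suc h r x) (cancel i (suc r) (trans eq (cong (λ k → iter h k x) (sym (ℕₚ.+-suc i r)))))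

    orb-sym : ∀ {x y} → Orb h x y → Orb h y x
    orb-sym {x} o = orb-preserves (λ y → Orb h y x) back o orb-refl
      where
      back : ∀ {y} → Orb h y x → Orb h (h y) x
      back {y} o = let p , _ , e = period y in orb-trans (p , e) o

  -- Composition with a transposition merges two orbits or splits one.

  module Transposition {h h' : A → A}
    (h-inj : ∀ {x y} → h x ≡ h y → x ≡ y) (h'-inj : ∀ {x y} → h' x ≡ h' y → x ≡ y)
    {a b : A} (a≢b : a ≢ b) (h'a : h' a ≡ h b) (h'b : h' b ≡ h a)
    (off : ∀ {x} → x ≢ a → x ≢ b → h' x ≡ h x) where

    private
      follow : ¬ Orb h a b → ∀ n z → Orb h b z → iter h n z ≡ b → Orb h' z b
      follow a≁b zero    z o refl = orb-refl
      follow a≁b (suc n) z o e with z ≟ b | z ≟ a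
      ... | yes refl | _        = orb-refl
      ... | no z≢b   | yes refl = ⊥-elim (a≁b (orb-sym h-inj o))
      ... | no z≢b   | no z≢a   = orb-trans orb-step (subst (λ w → Orb h' w b) (sym (off z≢a z≢b))
                                    (follow a≁b n (h z) (orb-trans o orb-step) (trans (iter-suc h n z) e)))

    -- From `a`, the map `h'` jumps to `h b` and then runs along the `h`-cycle of `b`. As `a` is not
    -- on this cycle, `h'` agrees with `h` there until `b` is reached.
    joined : ¬ Orb h a b → Orb h' a b
    joined a≁b = let p , _ , e = period h-inj b in
      orb-trans orb-step (subst (λ w → Orb h' w b) (sym h'a) (follow a≁b p (h b) orb-step e))

    coarser : ¬ Orb h a b → ∀ {x y} → Orb h x y → Orb h' x y
    coarser a≁b {x} o = orb-preserves (Orb h' x) next o orb-refl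
      where
      next : ∀ {y} → Orb h' x y → Orb h' x (h y)
      next {y} o with y ≟ a | y ≟ b
      ... | yes refl | _ = subst (Orb h' x) h'b (orb-trans o (orb-trans (joined a≁b) orb-step))
      ... | _ | yes refl = subst (Orb h' x) h'a (orb-trans o (orb-trans (orb-sym h'-inj (joined a≁b)) orb-step))
      ... | no y≢a | no y≢b = subst (Orb h' x) (off y≢a y≢b) (orb-trans o orb-step)

    Glued : A → A → Set
    Glued x y = Orb h x y ⊎ (Orb h x a × Orb h b y) ⊎ (Orb h x b × Orb h a y)

    glued : ∀ {x y} → Orb h' x y → Glued x y
    glued {x} o = orb-preserves (Glued x) next o (inj₁ orb-refl)
      where
      next : ∀ {y} → Glued x y → Glued x (h' y)
      next {y} g with y ≟ a | y ≟ b
      next g | yes refl | _ rewrite h'a = [ (λ o → inj₂ (inj₁ (o , orb-step)))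
        , [ (λ (o , _) → inj₂ (inj₁ (o , orb-step))) , (λ (o , _) → inj₁ (orb-trans o orb-step)) ]′ ]′ g
      next g | no _ | yes refl rewrite h'b = [ (λ o → inj₂ (inj₂ (o , orb-step)))
        , [ (λ (o , _) → inj₁ (orb-trans o orb-step)) , (λ (o , _) → inj₂ (inj₂ (o , orb-step))) ]′ ]′ g
      next g | no y≢a | no y≢b rewrite off y≢a y≢b = [ (λ o → inj₁ (orb-trans o orb-step))
        , [ (λ (o , p) → inj₂ (inj₁ (o , orb-trans p orb-step)))
          , (λ (o , p) → inj₂ (inj₂ (o , orb-trans p orb-step))) ]′ ]′ g

    private
      -- z reaches b under h without passing through a
      data To : A → Set where
        stop : ∀ {z} → z ≡ b → To z
        go   : ∀ {z} → z ≢ a → z ≢ b → To (h z) → To z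

      walk : ∀ n z → iter h n z ≡ b → To z ⊎ (∃[ m ] (m ≤ n × iter h m a ≡ b))
      walk zero    z e = inj₁ (stop e)
      walk (suc n) z e with z ≟ b | z ≟ a
      ... | yes z≡b | _       = inj₁ (stop z≡b)
      ... | no _    | yes refl = inj₂ (suc n , ℕₚ.≤-refl , e)
      ... | no z≢b  | no z≢a  with walk n (h z) (trans (iter-suc h n z) e)
      ... | inj₁ t             = inj₁ (go z≢a z≢b t)
      ... | inj₂ (m , m≤n , e') = inj₂ (m , ℕₚ.m≤n⇒m≤1+n m≤n , e')

      -- If the path from `h a` to `b` meets `a` again, the rest of it is a strictly shorter path
      -- from `a` to `b`. The bound `k` makes this descent structural.
      lastPassage : ∀ k n → n ≤ k → iter h n a ≡ b → To (h a)
      lastPassage k       zero    _       e = ⊥-elim (a≢b e)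
      lastPassage (suc k) (suc n) (s≤s l) e with walk n (h a) (trans (iter-suc h n a) e)
      ... | inj₁ t              = t
      ... | inj₂ (m , m≤n , e') = lastPassage k m (ℕₚ.≤-trans m≤n l) e'

    -- The points that reach `b` under `h` without meeting `a` form an `h'`-closed set: `b` itself
    -- is sent to `h a`, which belongs to it by the last passage. The set contains `b` but not `a`.
    cut : Orb h a b → ¬ Orb h' a b
    cut (n , e) o = avoids (orb-preserves To closed (orb-sym h'-inj o) (stop refl))
      where
      closed : ∀ {z} → To z → To (h' z)
      closed (stop refl)      = subst To (sym h'b) (lastPassage n n ℕₚ.≤-refl e)
      closed (go z≢a z≢b t) = subst To (sym (off z≢a z≢b)) t
      avoids : ¬ To a
      avoids (stop e)     = a≢b e
      avoids (go a≢a _ _) = a≢a refl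

    drop-merged : ∀ {P xs} → ¬ Orb h a b → P a → Transversal (Orb h) P (b ∷ xs) → Transversal (Orb h') P xs
    drop-merged {P} {xs} a≁b pa t with sound t | separate t
    ... | _ ∷ ps | n ∷ ns = record
      { sound = ps
      ; separate = allPairs-refine sep (All.tabulate id) ns
      ; complete = λ py → let z , z∈ , o = complete t py in conv z∈ o }
      where
      b≁ : ∀ {x} → x ∈ₗ xs → ¬ Orb h b x
      b≁ = All.lookup n
      sep : ∀ {x y} → x ∈ₗ xs → y ∈ₗ xs → ¬ Orb h x y → ¬ Orb h' x y
      sep x∈ y∈ nxy o = [ nxy , [ (λ (_ , q) → b≁ y∈ q) , (λ (p , _) → b≁ x∈ (orb-sym h-inj p)) ]′ ]′ (glued o)
      conv : ∀ {z y} → z ∈ₗ b ∷ xs → Orb h z y → ∃[ w ] (w ∈ₗ xs × Orb h' w y)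
      conv (there i) o = _ , i , coarser a≁b o
      conv (here refl) o with complete t pa
      ... | _ , here refl , q = ⊥-elim (a≁b (orb-sym h-inj q))
      ... | w , there i   , q = w , i , orb-trans (coarser a≁b q) (orb-trans (joined a≁b) (coarser a≁b o))

    -- Leads from `h'` back to `h`, the finer of the two. Used with the maps exchanged, it describes
    -- an edge drawn inside a single face.
    add-split : ∀ {P xs} → ¬ Orb h a b → P b → Transversal (Orb h') P (a ∷ xs) → Transversal (Orb h) P (a ∷ b ∷ xs)
    add-split {P} {xs} a≁b pb t with sound t | separate t
    ... | pa ∷ ps | n ∷ ns = record
      { sound = pa ∷ pb ∷ ps
      ; separate = (a≁b ∷ All.map (λ m o → m (coarser a≁b o)) n)
                 ∷ All.map (λ m o → m (orb-trans (joined a≁b) (coarser a≁b o))) n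
                 ∷ AllPairs.map (λ m o → m (coarser a≁b o)) ns
      ; complete = λ py → let z , z∈ , o = complete t py in conv z∈ (glued o) }
      where
      a≁' : ∀ {x} → x ∈ₗ xs → ¬ Orb h' a x
      a≁' = All.lookup n
      conv : ∀ {z y} → z ∈ₗ a ∷ xs → Glued z y → ∃[ w ] (w ∈ₗ a ∷ b ∷ xs × Orb h w y)
      conv (here refl) (inj₁ o)              = a , here refl , o
      conv (here refl) (inj₂ (inj₁ (_ , o))) = b , there (here refl) , o
      conv (here refl) (inj₂ (inj₂ (_ , o))) = a , here refl , o
      conv (there i)   (inj₁ o)              = _ , there (there i) , o
      conv (there i)   (inj₂ (inj₁ (o , _))) = ⊥-elim (a≁' i (orb-sym h'-inj (coarser a≁b o)))
      conv (there i)   (inj₂ (inj₂ (o , _))) =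
        ⊥-elim (a≁' i (orb-trans (joined a≁b) (orb-sym h'-inj (coarser a≁b o))))

T⇒≡ : ∀ {b} → T b → b ≡ true
T⇒≡ = Equivalence.to Boolₚ.T-≡

≡⇒T : ∀ {b} → b ≡ true → T b
≡⇒T = Equivalence.from Boolₚ.T-≡

true≢false : ∀ {b} → b ≡ true → b ≡ false → ⊥
true≢false refl ()

-- Boolean subsets of Fin n

module _ {n : ℕ} where

  insert : Fin n → (Fin n → Bool) → Fin n → Bool
  insert i p j = p j ∨ does (j Finₚ.≟ i)

  insert-new : ∀ i (p : Fin n → Bool) → insert i p i ≡ true
  insert-new i p rewrite dec-true (i Finₚ.≟ i) refl = Boolₚ.∨-zeroʳ (p i)

  insert-old : ∀ i p {j} → p j ≡ true → insert i p j ≡ true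
  insert-old i p pj rewrite pj = refl

  insert-other : ∀ i p {j} → j ≢ i → insert i p j ≡ p j
  insert-other i p {j} j≢i rewrite dec-false (j Finₚ.≟ i) j≢i = Boolₚ.∨-identityʳ (p j)

  insert-elim : ∀ i p {j} → insert i p j ≡ true → p j ≡ true ⊎ j ≡ i
  insert-elim i p {j} e with j Finₚ.≟ i
  ... | yes j≡i = inj₂ j≡i
  ... | no _    = inj₁ (trans (sym (Boolₚ.∨-identityʳ (p j))) e)

  open Transversals {Fin n} _≡_ refl sym trans

  count-transversal : (p : Fin n → Bool) → Transversal _≡_ (λ i → p i ≡ true) (filter (λ i → T? (p i)) (allFin n))
  count-transversal p = record
    { sound    = All.tabulate (λ i∈ → T⇒≡ (proj₂ (∈-filter⁻ (λ i → T? (p i)) {xs = allFin n} i∈)))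
    ; separate = Uniqueₚ.filter⁺ (λ i → T? (p i)) (Uniqueₚ.allFin⁺ n)
    ; complete = λ {i} pi → i , ∈-filter⁺ (λ i → T? (p i)) (∈-allFin i) (≡⇒T pi) , refl }

  count-cong : ∀ {p q : Fin n → Bool} → (∀ i → p i ≡ q i) → count p ≡ count q
  count-cong {p} {q} e = cong length (Listₚ.filter-≐ (λ i → T? (p i)) (λ i → T? (q i))
    ((λ {i} → subst T (e i)) , (λ {i} → subst T (sym (e i)))) (allFin n))

  count-insert : ∀ i (p : Fin n → Bool) → p i ≡ false → count (insert i p) ≡ suc (count p)
  count-insert i p pi = length-unique (count-transversal (insert i p)) record
    { sound    = insert-new i p ∷ All.map (insert-old i p) (sound t)
    ; separate = All.map (λ { pj refl → true≢false pj pi }) (sound t) ∷ separate t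
    ; complete = λ e → [ (λ pj → let k , k∈ , eq = complete t pj in k , there k∈ , eq)
                       , (λ { refl → i , here refl , refl }) ]′ (insert-elim i p e) }
    where t = count-transversal p

  count-empty : count {n} (const false) ≡ 0
  count-empty = length-unique (count-transversal (const false))
    record { sound = [] ; separate = [] ; complete = λ () }

  count-≤ : (p : Fin n → Bool) → count p ≤ n
  count-≤ p = subst (count p ≤_) (Listₚ.length-tabulate id) (Listₚ.length-filter (λ i → T? (p i)) (allFin n))

-- Sums over 𝔽₂

sum-false : ∀ {n} {t : Fin n → Bool} → (∀ i → t i ≡ false) → sum t ≡ false
sum-false {zero}  e = refl
sum-false {suc n} e = cong₂ _xor_ (e zero) (sum-false (e ∘ suc))

sum-change : ∀ {n} {s t : Fin n → Bool} (i : Fin n) → s i ≡ false → (∀ {j} → j ≢ i → t j ≡ s j)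
  → sum t ≡ sum s xor t i
sum-change {suc n} {s} {t} zero si e rewrite si =
  trans (cong (t zero xor_) (sum-cong-≗ (λ j → e {suc j} λ ()))) (Boolₚ.xor-comm (t zero) _)
sum-change {suc n} {s} {t} (suc i) si e = begin
  t zero xor sum (t ∘ suc)                   ≡⟨ cong₂ _xor_ (e λ ()) (sum-change i si (λ j≢i → e (j≢i ∘ Finₚ.suc-injective))) ⟩
  s zero xor (sum (s ∘ suc) xor t (suc i))   ≡⟨ Boolₚ.xor-assoc (s zero) _ _ ⟨
  (s zero xor sum (s ∘ suc)) xor t (suc i)   ∎
  where open ≡-Reasoning

-- Darts as a finite set, and sums over darts.

code : ∀ {n} → Dart n → Fin (n * 2)
code (zero  , false) = zero
code (zero  , true)  = suc zero
code (suc e , b)     = suc (suc (code (e , b)))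

decode : ∀ {n} → Fin (n * 2) → Dart n
decode {suc n} zero          = zero , false
decode {suc n} (suc zero)    = zero , true
decode {suc n} (suc (suc i)) = let e , b = decode i in suc e , b

code-decode : ∀ {n} (i : Fin (n * 2)) → code (decode {n} i) ≡ i
code-decode {suc n} zero          = refl
code-decode {suc n} (suc zero)    = refl
code-decode {suc n} (suc (suc i)) = cong (λ j → suc (suc j)) (code-decode i)

decode-code : ∀ {n} (d : Dart n) → decode (code d) ≡ d
decode-code (zero  , false) = refl
decode-code (zero  , true)  = refl
decode-code (suc e , b)     rewrite decode-code (e , b) = refl

code-injective : ∀ {n} {d d' : Dart n} → code d ≡ code d' → d ≡ d'
code-injective e = trans (sym (decode-code _)) (trans (cong decode e) (decode-code _))

dartSum : ∀ {n} → (Dart n → Bool) → Bool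
dartSum w = sum λ e → w (e , false) xor w (e , true)

dartSum-decode : ∀ {n} (w : Dart n → Bool) → sum (w ∘ decode) ≡ dartSum w
dartSum-decode {zero}  w = refl
dartSum-decode {suc n} w = trans
  (cong (λ s → w (zero , false) xor (w (zero , true) xor s)) (dartSum-decode (λ (e , b) → w (suc e , b))))
  (sym (Boolₚ.xor-assoc (w (zero , false)) _ _))

dartSum-permute : ∀ {n} (r r⁻ : Dart n → Dart n) → (∀ d → r⁻ (r d) ≡ d) → (∀ d → r (r⁻ d) ≡ d)
  → ∀ w → dartSum (w ∘ r) ≡ dartSum w
dartSum-permute r r⁻ inv₁ inv₂ w = begin
  dartSum (w ∘ r)                           ≡⟨ dartSum-decode (w ∘ r) ⟨
  sum (w ∘ r ∘ decode)                      ≡⟨ sum-cong-≗ (λ i → cong w (decode-code (r (decode i)))) ⟨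
  sum (w ∘ decode ∘ code ∘ r ∘ decode)      ≡⟨ sum-permute (w ∘ decode) π ⟨
  sum (w ∘ decode)                          ≡⟨ dartSum-decode w ⟩
  dartSum w                                 ∎
  where
  open ≡-Reasoning
  π : Permutation _ _
  π = permutation (code ∘ r ∘ decode) (code ∘ r⁻ ∘ decode)
    (λ i → trans (cong (code ∘ r) (decode-code _)) (trans (cong code (inv₂ _)) (code-decode i)))
    (λ i → trans (cong (code ∘ r⁻) (decode-code _)) (trans (cong code (inv₁ _)) (code-decode i)))

flip-involutive : ∀ {n} (d : Dart n) → flipD (flipD d) ≡ d
flip-involutive (e , b) = cong (e ,_) (Boolₚ.not-involutive b)

flip-≢ : ∀ {n} (d : Dart n) → d ≢ flipD d
flip-≢ (e , false) ()
flip-≢ (e , true)  ()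

same-edge : ∀ {n} (d d' : Dart n) → proj₁ d' ≡ proj₁ d → d' ≡ d ⊎ d' ≡ flipD d
same-edge (e , false) (.e , false) refl = inj₁ refl
same-edge (e , false) (.e , true)  refl = inj₂ refl
same-edge (e , true)  (.e , false) refl = inj₂ refl
same-edge (e , true)  (.e , true)  refl = inj₁ refl

orb-cong : {A : Set} {h h' : A → A} → (∀ x → h x ≡ h' x) → ∀ {x y} → Orb h x y → Orb h' x y
orb-cong {h' = h'} e {x} o =
  orb-preserves (Orb h' x) (λ {y} o' → subst (Orb h' x) (sym (e y)) (orb-trans o' orb-step)) o orb-refl

any-dart? : ∀ {n} {P : Dart n → Set} → (∀ d → Dec (P d)) → Dec (∃[ d ] P d)
any-dart? P? = map′ [ (λ (e , p) → (e , false) , p) , (λ (e , p) → (e , true) , p) ]′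
  (λ { ((e , false) , p) → inj₁ (e , p) ; ((e , true) , p) → inj₂ (e , p) })
  (Finₚ.any? (λ e → P? (e , false)) ⊎-dec Finₚ.any? (λ e → P? (e , true)))

-- Faces of an edge set as orbits on all darts of the graph.

module Surface (G : EmbeddedGraph) where
  open EmbeddedGraph G

  Edges Verts : Set
  Edges = Fin nE → Bool
  Verts = Fin nV → Bool

  rot-injective : ∀ {d d'} → rot d ≡ rot d' → d ≡ d'
  rot-injective e = trans (sym (rot-inv₁ _)) (trans (cong rot⁻ e) (rot-inv₁ _))

  flipOn : Edges → Dart nE → Dart nE
  flipOn X d = if X (proj₁ d) then flipD d else d

  -- Face tracing of the subgraph with edge set X, carried out on all darts of G: a dart
  -- outside X is passed over.  The orbits are the faces of X and, for each vertex not
  -- touched by X, the set of all darts at that vertex.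
  trace : Edges → Dart nE → Dart nE
  trace X d = rot (flipOn X d)

  trace-in : ∀ X {d} → X (proj₁ d) ≡ true → trace X d ≡ rot (flipD d)
  trace-in X e rewrite e = refl

  trace-out : ∀ X {d} → X (proj₁ d) ≡ false → trace X d ≡ rot d
  trace-out X e rewrite e = refl

  trace-cong : ∀ {X Y d} → X (proj₁ d) ≡ Y (proj₁ d) → trace X d ≡ trace Y d
  trace-cong {d = d} e = cong (λ b → rot (if b then flipD d else d)) e

  flipOn-involutive : ∀ X d → flipOn X (flipOn X d) ≡ d
  flipOn-involutive X d with X (proj₁ d) in eq
  ... | true  rewrite eq = flip-involutive d
  ... | false rewrite eq = refl

  trace-injective : ∀ X {d d'} → trace X d ≡ trace X d' → d ≡ d'
  trace-injective X {d} {d'} e = trans (sym (flipOn-involutive X d))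
    (trans (cong (flipOn X) (rot-injective e)) (flipOn-involutive X d'))

  -- The vertices are added so that a vertex of degree 0 in G also has an item, for its trivial face.
  Item : Set
  Item = Dart nE ⊎ Fin nV

  itemCode : Item → Fin (nE * 2 + nV)
  itemCode = join (nE * 2) nV ∘ Sum.map₁ code

  itemCode-injective : ∀ {i j} → itemCode i ≡ itemCode j → i ≡ j
  itemCode-injective {i} {j} e = map₁-injective i j
    (trans (sym (Finₚ.splitAt-join (nE * 2) nV _)) (trans (cong (splitAt (nE * 2)) e) (Finₚ.splitAt-join (nE * 2) nV _)))
    where
    map₁-injective : ∀ i j → Sum.map₁ code i ≡ Sum.map₁ code j → i ≡ j
    map₁-injective (inj₁ d) (inj₁ d') e = cong inj₁ (code-injective (Sumₚ.inj₁-injective e))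
    map₁-injective (inj₂ u) (inj₂ u') e = cong inj₂ (Sumₚ.inj₂-injective e)

  traceI : Edges → Item → Item
  traceI X = Sum.map₁ (trace X)

  traceI-injective : ∀ X {i j} → traceI X i ≡ traceI X j → i ≡ j
  traceI-injective X {inj₁ d} {inj₁ d'} e = cong inj₁ (trace-injective X (Sumₚ.inj₁-injective e))
  traceI-injective X {inj₂ u} {inj₂ u'} e = e

  open Finite itemCode itemCode-injective

  FaceEq : Edges → Item → Item → Set
  FaceEq X = Orb (traceI X)

  SameFace : Edges → Dart nE → Dart nE → Set
  SameFace X d d' = FaceEq X (inj₁ d) (inj₁ d')

  sameFace? : ∀ X d d' → Dec (SameFace X d d')
  sameFace? X d d' = orb? (traceI X) (inj₁ d) (inj₁ d')

  faceEq-sym : ∀ X {i j} → FaceEq X i j → FaceEq X j i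
  faceEq-sym X = orb-sym (traceI-injective X)

  module Faces (X : Edges) = Transversals (FaceEq X) orb-refl (faceEq-sym X) orb-trans

  _∪e_ : Edges → Dart nE → Edges
  X ∪e d = insert (proj₁ d) X

  _∪v_ : Verts → Dart nE → Verts
  W ∪v d = insert (end d) W

  -- Since `trace` passes over darts outside `X`, adding an edge merely precomposes it with the
  -- transposition of the two darts of that edge. Merging and splitting of faces thus become
  -- statements about permutations.
  module Toggle (X : Edges) (d : Dart nE) (new : X (proj₁ d) ≡ false) where

    private
      a b : Item
      a = inj₁ d
      b = inj₁ (flipD d)
      a≢b : a ≢ b
      a≢b e = flip-≢ d (Sumₚ.inj₁-injective e)
      now : ∀ d' → (X ∪e d) (proj₁ d') ≡ true → traceI (X ∪e d) (inj₁ d') ≡ inj₁ (rot (flipD d'))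
      now d' e = cong inj₁ (trace-in (X ∪e d) e)
      fore : ∀ d' → X (proj₁ d') ≡ false → traceI X (inj₁ d') ≡ inj₁ (rot d')
      fore d' e = cong inj₁ (trace-out X e)
      ha : traceI (X ∪e d) a ≡ traceI X b
      ha = trans (now d (insert-new _ X)) (sym (fore (flipD d) new))
      hb : traceI (X ∪e d) b ≡ traceI X a
      hb = trans (now (flipD d) (insert-new _ X))
        (trans (cong (inj₁ ∘ rot) (flip-involutive d)) (sym (fore d new)))
      off : ∀ {i} → i ≢ a → i ≢ b → traceI (X ∪e d) i ≡ traceI X i
      off {inj₂ u}  _   _   = refl
      off {inj₁ d'} i≢a i≢b = cong inj₁ (trace-cong {X = X ∪e d} {Y = X} (insert-other _ X λ e →
        [ (λ { refl → i≢a refl }) , (λ { refl → i≢b refl }) ]′ (same-edge d d' e)))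

    module Add    = Transposition {traceI X} {traceI (X ∪e d)} (traceI-injective X)
                      (traceI-injective (X ∪e d)) a≢b ha hb off
    module Remove = Transposition {traceI (X ∪e d)} {traceI X} (traceI-injective (X ∪e d))
                      (traceI-injective X) a≢b (sym hb) (sym ha) (λ p q → sym (off p q))

  Supported : Edges → Verts → Set
  Supported X W = ∀ d → X (proj₁ d) ≡ true → W (end d) ≡ true

  -- A dart stands for a corner at its vertex even if its edge is absent from the current subgraph.
  -- A vertex item counts only where there is no such corner, so that no face is counted twice.
  Within : Verts → Item → Set
  Within W (inj₁ d) = W (end d) ≡ true
  Within W (inj₂ u) = W u ≡ true × (∀ d → end d ≢ u)

  supported-trace : ∀ {X W} → Supported X W → ∀ {i} → Within W i → Within W (traceI X i)
  supported-trace {X} {W} sup {inj₂ u} w = w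
  supported-trace {X} {W} sup {inj₁ d} w with X (proj₁ d) in eq
  ... | true  = trans (cong W (rot-end _)) (sup (flipD d) eq)
  ... | false = trans (cong W (rot-end _)) w

  leaf-separate : ∀ {X W d} → Supported X W → W (end d) ≡ true → W (end (flipD d)) ≡ false
    → ¬ SameFace X d (flipD d)
  leaf-separate {X} {W} sup old new o =
    true≢false (orb-preserves (Within W) (λ {i} → supported-trace {X} {W} sup {i}) o old) new

  supported-leaf : ∀ {X W} d → Supported X W → W (end d) ≡ true → Supported (X ∪e d) (W ∪v flipD d)
  supported-leaf {X} {W} d sup old d' e with insert-elim _ X e
  ... | inj₁ x = insert-old _ W (sup d' x)
  ... | inj₂ same with same-edge d d' same
  ... | inj₁ refl = insert-old _ W old
  ... | inj₂ refl = insert-new _ W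

  supported-chord : ∀ {X W} d → Supported X W → W (end d) ≡ true → W (end (flipD d)) ≡ true
    → Supported (X ∪e d) W
  supported-chord {X} d sup old old' d' e with insert-elim _ X e
  ... | inj₁ x = sup d' x
  ... | inj₂ same with same-edge d d' same
  ... | inj₁ refl = old
  ... | inj₂ refl = old'

  -- Chains of edge additions and the relative Euler formula.

  Untouched : Edges → Fin nV → Set
  Untouched X u = ∀ d → end d ≡ u → X (proj₁ d) ≡ false

  untouched-rot : ∀ {X u} → Untouched X u → ∀ i {d} → end d ≡ u → SameFace X d (iter rot i d)
  untouched-rot unt zero    e = orb-refl
  untouched-rot {X} {u} unt (suc i) {d} e = orb-trans (untouched-rot unt i e)
    (1 , cong inj₁ (trace-out X (unt (iter rot i d) (trans (at i) e))))
    where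
    at : ∀ i → end (iter rot i d) ≡ end d
    at zero    = refl
    at (suc i) = trans (rot-end _) (at i)

  untouched-same : ∀ {X u} → Untouched X u → ∀ d d' → end d ≡ u → end d' ≡ u → SameFace X d d'
  untouched-same unt d d' e e' with rot-cyclic d d' (trans e (sym e'))
  ... | i , refl = untouched-rot unt i e

  -- Y is reached from X by adding edges one at a time, each having an end among the
  -- current vertices; q counts the edges that join two different faces.
  data Chain (Y : Edges) (Z : Verts) (X : Edges) (W : Verts) : ℕ → Set where
    done  : (∀ e → X e ≡ Y e) → (∀ u → W u ≡ Z u) → Chain Y Z X W 0
    leaf  : ∀ {q} d → X (proj₁ d) ≡ false → Y (proj₁ d) ≡ true
          → W (end d) ≡ true → W (end (flipD d)) ≡ false
          → Chain Y Z (X ∪e d) (W ∪v flipD d) q → Chain Y Z X W q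
    split : ∀ {q} d → X (proj₁ d) ≡ false → Y (proj₁ d) ≡ true
          → W (end d) ≡ true → W (end (flipD d)) ≡ true → SameFace X d (flipD d)
          → Chain Y Z (X ∪e d) W q → Chain Y Z X W q
    cross : ∀ {q} d → X (proj₁ d) ≡ false → Y (proj₁ d) ≡ true
          → W (end d) ≡ true → W (end (flipD d)) ≡ true → ¬ SameFace X d (flipD d)
          → Chain Y Z (X ∪e d) W q → Chain Y Z X W (suc q)

  chain-⊆ : ∀ {X W Y Z q} → Chain Y Z X W q → ∀ e → X e ≡ true → Y e ≡ true
  chain-⊆ (done x _)            e p = trans (sym (x e)) p
  chain-⊆ {X} (leaf d _ _ _ _ c)    e p = chain-⊆ c e (insert-old _ X p)
  chain-⊆ {X} (split d _ _ _ _ _ c) e p = chain-⊆ c e (insert-old _ X p)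
  chain-⊆ {X} (cross d _ _ _ _ _ c) e p = chain-⊆ c e (insert-old _ X p)

  FaceReps : Edges → Verts → List Item → Set
  FaceReps X W = Transversal (FaceEq X) (Within W)

  faceReps-cong : ∀ {X Y W Z xs} → (∀ e → X e ≡ Y e) → (∀ u → W u ≡ Z u)
    → FaceReps X W xs → FaceReps Y Z xs
  faceReps-cong {X} {Y} {W} {Z} eE eV t = record
    { sound = All.map (λ {i} → to i) (sound t)
    ; separate = AllPairs.map (λ n o → n (orb-cong (λ i → sym (same i)) o)) (separate t)
    ; complete = λ {i} p → map₂ (map₂ (orb-cong same)) (complete t (from i p)) }
    where
    same : ∀ i → traceI X i ≡ traceI Y i
    same (inj₁ d) = cong inj₁ (trace-cong {X} {Y} (eE (proj₁ d)))
    same (inj₂ u) = refl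
    to : ∀ i → Within W i → Within Z i
    to (inj₁ d) w = trans (sym (eV _)) w
    to (inj₂ u) (w , z) = trans (sym (eV _)) w , z
    from : ∀ i → Within Z i → Within W i
    from (inj₁ d) w = trans (eV _) w
    from (inj₂ u) (w , z) = trans (eV _) w , z

  -- Before the edge is added, the darts at the new vertex form an orbit of their own. The edge
  -- merges this orbit with the face at `end d`, so the old list of representatives still serves.
  leaf-reps : ∀ {X W xs} d → X (proj₁ d) ≡ false → Supported X W → W (end d) ≡ true → W (end (flipD d)) ≡ false
    → FaceReps X W xs → FaceReps (X ∪e d) (W ∪v flipD d) xs
  leaf-reps {X} {W} {xs} d new sup old fresh t = Toggle.Add.drop-merged X d new apart (insert-old _ W old) t⁺
    where
    apart : ¬ SameFace X d (flipD d)
    apart = leaf-separate {X} {W} sup old fresh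
    unt : Untouched X (end (flipD d))
    unt d' e with X (proj₁ d') in eq
    ... | false = refl
    ... | true  = ⊥-elim (true≢false (subst (λ u → W u ≡ true) e (sup d' eq)) fresh)
    enlarge : ∀ i → Within W i → Within (W ∪v flipD d) i
    enlarge (inj₁ d') w       = insert-old _ W w
    enlarge (inj₂ u)  (w , z) = insert-old _ W w , z
    other : ∀ i → Within W i → ¬ FaceEq X (inj₁ (flipD d)) i
    other i w o = true≢false
      (orb-preserves (Within W) (λ {i} → supported-trace {X} {W} sup {i}) (faceEq-sym X o) w) fresh
    represent : ∀ i → Within (W ∪v flipD d) i → ∃[ x ] (x ∈ₗ inj₁ (flipD d) ∷ xs × FaceEq X x i)
    represent (inj₁ d') w with insert-elim _ W w
    ... | inj₁ w' = let x , x∈ , o = complete t {inj₁ d'} w' in x , there x∈ , o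
    ... | inj₂ e  = _ , here refl , untouched-same unt (flipD d) d' refl e
    represent (inj₂ u) (w , z) with insert-elim _ W w
    ... | inj₁ w' = let x , x∈ , o = complete t {inj₂ u} (w' , z) in x , there x∈ , o
    ... | inj₂ e  = ⊥-elim (z (flipD d) (sym e))
    t⁺ : FaceReps X (W ∪v flipD d) (inj₁ (flipD d) ∷ xs)
    t⁺ = record { sound = insert-new _ W ∷ All.map (λ {i} → enlarge i) (sound t)
                ; separate = All.map (λ {i} → other i) (sound t) ∷ separate t
                ; complete = λ {i} → represent i }

  split-reps : ∀ {X W xs} d → X (proj₁ d) ≡ false → W (end d) ≡ true → W (end (flipD d)) ≡ true
    → SameFace X d (flipD d) → FaceReps X W xs → ∃[ ys ] (length ys ≡ suc (length xs) × FaceReps (X ∪e d) W ys)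
  split-reps {X} {W} d new old old' same t =
    let zs , len , s = Faces.choose X {P = Within W} {a = inj₁ d} t old in _ , cong suc (sym len)
      , Toggle.Remove.add-split X d new (Toggle.Add.cut X d new same) old' s

  cross-reps : ∀ {X W xs} d → X (proj₁ d) ≡ false → W (end d) ≡ true → W (end (flipD d)) ≡ true
    → ¬ SameFace X d (flipD d) → FaceReps X W xs → ∃[ ys ] (suc (length ys) ≡ length xs × FaceReps (X ∪e d) W ys)
  cross-reps {X} {W} d new old old' apart t =
    let zs , len , s = Faces.choose X {P = Within W} {a = inj₁ (flipD d)} t old' in zs , sym len , Toggle.Add.drop-merged X d new apart old s

  -- In a form free of subtraction: the Euler characteristic drops by `2 * q`. A leaf adds a vertex
  -- and an edge, a split adds an edge and a face, and a cross adds an edge and loses a face.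
  euler : ∀ {X W Y Z q xs ys} → Supported X W → Chain Y Z X W q → FaceReps X W xs → FaceReps Y Z ys
    → count Y + (count W + length xs) ≡ count X + (count Z + length ys + 2 * q)
  euler {Y = Y} sup (done eE eV) t t' = cong₂ _+_ (sym (count-cong eE))
    (trans (cong₂ _+_ (count-cong eV) (Faces.length-unique Y (faceReps-cong eE eV t) t')) (sym (ℕₚ.+-identityʳ _)))
  euler {X} {W} {Y} {xs = xs} sup (leaf d new _ old fresh c) t t' =
    arith (count Y) (count W) (length xs) (count-insert _ X new) (count-insert _ W fresh)
      (euler (supported-leaf {X} {W} d sup old) c (leaf-reps d new sup old fresh t) t')
    where
    arith : ∀ y w {x⁺ x w⁺ r} l → x⁺ ≡ suc x → w⁺ ≡ suc w → y + (w⁺ + l) ≡ x⁺ + r → y + (w + l) ≡ x + r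
    arith y w l refl refl e = ℕₚ.suc-injective (trans (sym (ℕₚ.+-suc y _)) e)
  euler {X} {W} {Y} {Z} {q} {xs} {ys} sup (split d new _ old old' same c) t t' =
    next (split-reps d new old old' same t)
    where
    arith : ∀ y w {x⁺ x l l⁺ r} → x⁺ ≡ suc x → l⁺ ≡ suc l → y + (w + l⁺) ≡ x⁺ + r → y + (w + l) ≡ x + r
    arith y w {l = l} refl refl e =
      ℕₚ.suc-injective (trans (sym (trans (cong (y +_) (ℕₚ.+-suc w l)) (ℕₚ.+-suc y _))) e)
    next : ∃[ zs ] (length zs ≡ suc (length xs) × FaceReps (X ∪e d) W zs)
      → count Y + (count W + length xs) ≡ count X + (count Z + length ys + 2 * q)
    next (zs , len , s) = arith (count Y) (count W) (count-insert _ X new) len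
      (euler (supported-chord {X} {W} d sup old old') c s t')
  euler {X} {W} {Y} {Z} {suc q} {xs} {ys} sup (cross d new _ old old' apart c) t t' =
    next (cross-reps d new old old' apart t)
    where
    open +-*-Solver
    arith : ∀ y w z q {x⁺ x l l⁺} → x⁺ ≡ suc x → suc l ≡ l⁺ → y + (w + l) ≡ x⁺ + (z + 2 * q)
      → y + (w + l⁺) ≡ x + (z + 2 * suc q)
    arith y w z q {_} {x} {l} refl refl e = trans
      (solve 3 (λ y w l → y :+ (w :+ (con 1 :+ l)) := con 1 :+ (y :+ (w :+ l))) refl y w l)
      (trans (cong suc e)
        (solve 3 (λ x z q → con 1 :+ (con 1 :+ x :+ (z :+ con 2 :* q)) := x :+ (z :+ con 2 :* (con 1 :+ q))) refl x z q))
    next : ∃[ zs ] (suc (length zs) ≡ length xs × FaceReps (X ∪e d) W zs)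
      → count Y + (count W + length xs) ≡ count X + (count Z + length ys + 2 * suc q)
    next (zs , len , s) = arith (count Y) (count W) (count Z + length ys) q (count-insert _ X new) len
      (euler (supported-chord {X} {W} d sup old old') c s t')

  -- Every vertex of Z is joined to W by edges of Y.
  Linked : Edges → Verts → Verts → Set
  Linked Y Z W = ∀ (W' : Verts) → (∀ u → W u ≡ true → W' u ≡ true)
    → (∀ d → Y (proj₁ d) ≡ true → W' (end d) ≡ true → W' (end (flipD d)) ≡ true)
    → ∀ u → Z u ≡ true → W' u ≡ true

  ⊆-antisym : ∀ {n} {p q : Fin n → Bool} → (∀ i → p i ≡ true → q i ≡ true) → (∀ i → q i ≡ true → p i ≡ true)
    → ∀ i → p i ≡ q i
  ⊆-antisym {p = p} {q} f g i with p i in eq | q i in eq'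
  ... | true  | true  = refl
  ... | false | false = refl
  ... | true  | false = ⊥-elim (true≢false (f i eq) eq')
  ... | false | true  = ⊥-elim (true≢false (g i eq') eq)

  module _ {Y : Edges} {Z : Verts} (supY : Supported Y Z) where

    -- Greedy: any edge of `Y` outside `X` with an end in `W` may come next. If there is none, `W`
    -- is closed under the edges of `Y`, and `Linked` forces it to be all of `Z`.
    buildChain : ∀ k X W → k + count X ≡ suc nE → Supported X W → (∀ e → X e ≡ true → Y e ≡ true)
      → (∀ u → W u ≡ true → Z u ≡ true) → Linked Y Z W → ∃[ q ] Chain Y Z X W q
    -- The total is `suc nE`, one more than `count X` can be, so the fuel never runs out.
    buildChain zero    X W k sup X⊆Y W⊆Z link = ⊥-elim (ℕₚ.<⇒≱ (ℕₚ.≤-reflexive (sym k)) (count-≤ X))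
    buildChain (suc k) X W kX sup X⊆Y W⊆Z link
      with any-dart? (λ d → (X (proj₁ d) Boolₚ.≟ false) ×-dec (Y (proj₁ d) Boolₚ.≟ true) ×-dec (W (end d) Boolₚ.≟ true))
    ... | no none = 0 , done (⊆-antisym X⊆Y Y⊆X) (⊆-antisym W⊆Z Z⊆W)
      where
      inX : ∀ d → Y (proj₁ d) ≡ true → W (end d) ≡ true → X (proj₁ d) ≡ true
      inX d y w with X (proj₁ d) in eq
      ... | true  = refl
      ... | false = ⊥-elim (none (d , eq , y , w))
      Z⊆W : ∀ u → Z u ≡ true → W u ≡ true
      Z⊆W = link W (λ _ w → w) (λ d y w → sup (flipD d) (inX d y w))
      Y⊆X : ∀ e → Y e ≡ true → X e ≡ true
      Y⊆X e y = inX (e , false) y (Z⊆W _ (supY (e , false) y))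
    ... | yes (d , new , y , old) with W (end (flipD d)) in other
    ... | false = map₂ (leaf d new y old other)
      (buildChain k (X ∪e d) (W ∪v flipD d) k' (supported-leaf {X} {W} d sup old) X⁺⊆Y W⁺⊆Z
        (λ W' W⁺⊆ → link W' (λ u w → W⁺⊆ u (insert-old _ W w))))
      where
      k' : k + count (X ∪e d) ≡ suc nE
      k' = trans (cong (k +_) (count-insert _ X new)) (trans (ℕₚ.+-suc k _) kX)
      X⁺⊆Y : ∀ e → (X ∪e d) e ≡ true → Y e ≡ true
      X⁺⊆Y e x = [ X⊆Y e , (λ { refl → y }) ]′ (insert-elim _ X x)
      W⁺⊆Z : ∀ u → (W ∪v flipD d) u ≡ true → Z u ≡ true
      W⁺⊆Z u w = [ W⊆Z u , (λ { refl → supY (flipD d) y }) ]′ (insert-elim _ W w)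
    ... | true = [ (λ s → map₂ (split d new y old other s) rest)
                 , (λ n → let q , c = rest in suc q , cross d new y old other n c) ]′
                 (toSum (sameFace? X d (flipD d)))
      where
      k' : k + count (X ∪e d) ≡ suc nE
      k' = trans (cong (k +_) (count-insert _ X new)) (trans (ℕₚ.+-suc k _) kX)
      X⁺⊆Y : ∀ e → (X ∪e d) e ≡ true → Y e ≡ true
      X⁺⊆Y e x = [ X⊆Y e , (λ { refl → y }) ]′ (insert-elim _ X x)
      rest : ∃[ q ] Chain Y Z (X ∪e d) W q
      rest = buildChain k (X ∪e d) W k' (supported-chord {X} {W} d sup old other) X⁺⊆Y W⊆Z link

    chain : ∀ {X W} → Supported X W → (∀ e → X e ≡ true → Y e ≡ true)
      → (∀ u → W u ≡ true → Z u ≡ true) → Linked Y Z W → ∃[ q ] Chain Y Z X W q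
    chain {X} {W} = buildChain (suc nE ∸ count X) X W (ℕₚ.m∸n+n≡m (ℕₚ.m≤n⇒m≤1+n (count-≤ X)))

-- Closed and exact 1-forms over 𝔽₂

xor-≡ : ∀ a b → a xor b ≡ false → a ≡ b
xor-≡ false false e = refl
xor-≡ true  true  e = refl

xor-solve : ∀ {a b c} → c ≡ a xor b → b ≡ a xor c
xor-solve {false} refl = refl
xor-solve {true}  refl = sym (Boolₚ.not-involutive _)

xor-cancelˡ : ∀ a b → a xor (a xor b) ≡ b
xor-cancelˡ false b = refl
xor-cancelˡ true  b = Boolₚ.not-involutive b

module Forms (G : EmbeddedGraph) where
  open EmbeddedGraph G
  open Surface G

  ∂ : (Dart nE → Bool) → Fin nE → Bool
  ∂ f e = f (e , false) xor f (e , true)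

  δ : Verts → Fin nE → Bool
  δ v = ∂ (v ∘ end)

  ∂-dart : ∀ f d → ∂ f (proj₁ d) ≡ f d xor f (flipD d)
  ∂-dart f (e , false) = refl
  ∂-dart f (e , true)  = Boolₚ.xor-comm (f (e , false)) _

  ∂-flat : ∀ f d → f d ≡ f (flipD d) → ∂ f (proj₁ d) ≡ false
  ∂-flat f d e = trans (∂-dart f d) (trans (cong (_xor f (flipD d)) e) (Boolₚ.xor-same (f (flipD d))))

  Invariant : Edges → (Dart nE → Bool) → Set
  Invariant X f = ∀ d → f (trace X d) ≡ f d

  invariant-orb : ∀ {X f} → Invariant X f → ∀ {d d'} → SameFace X d d' → f d ≡ f d'
  invariant-orb {f = f} inv = orb-const [ f , const false ]′ λ { (inj₁ d) → inv d ; (inj₂ u) → refl }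

  -- Equal values on the two darts of an edge mean equal colours on its two sides, so inserting or
  -- deleting the edge does not disturb a colouring of faces.
  invariant-change : ∀ {X X' f} → Invariant X f → (∀ d → X (proj₁ d) ≢ X' (proj₁ d) → f d ≡ f (flipD d))
    → Invariant X' f
  invariant-change {X} {X'} {f} inv flat d with X (proj₁ d) in eq | X' (proj₁ d) in eq' 
  ... | true  | true  = trans (cong f (sym (trace-in X eq))) (inv d)
  ... | false | false = trans (cong f (sym (trace-out X eq))) (inv d)
  ... | false | true  = trans (cong f (sym (trace-out X {flipD d} eq)))
    (trans (inv (flipD d)) (sym (flat d λ e → true≢false (trans e eq') eq)))
  ... | true  | false = trans (cong (f ∘ rot) (sym (flip-involutive d)))
    (trans (cong f (sym (trace-in X {flipD d} eq))) (trans (inv (flipD d)) (sym (flat d λ e → true≢false eq (trans e eq')))))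

  invariant-xor : ∀ {X f g} → Invariant X f → Invariant X g → Invariant X (λ d → f d xor g d)
  invariant-xor inv inv' d = cong₂ _xor_ (inv d) (inv' d)

  flat-edge : ∀ (f : Dart nE → Bool) d → f d ≡ f (flipD d) → ∀ d' → proj₁ d' ≡ proj₁ d → f d' ≡ f (flipD d')
  flat-edge f d e d' same with same-edge d d' same
  ... | inj₁ refl = e
  ... | inj₂ refl = trans (sym e) (cong f (sym (flip-involutive d)))

  changed-edge : ∀ (X : Edges) (d : Dart nE) {d' : Dart nE} → X (proj₁ d') ≢ (X ∪e d) (proj₁ d') → proj₁ d' ≡ proj₁ d
  changed-edge X d {d'} n =
    [ id , (λ ne → ⊥-elim (n (sym (insert-other _ X ne)))) ]′ (toSum (proj₁ d' Finₚ.≟ proj₁ d))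

  invariant-add : ∀ {X} {f : Dart nE → Bool} d → Invariant X f → f d ≡ f (flipD d) → Invariant (X ∪e d) f
  invariant-add {X} {f} d inv e = invariant-change {X} {f = f} inv
    (λ d' n → flat-edge f d e d' (changed-edge X d {d'} n))

  invariant-remove : ∀ {X} {f : Dart nE → Bool} d → Invariant (X ∪e d) f → f d ≡ f (flipD d) → Invariant X f
  invariant-remove {X} {f} d inv e = invariant-change {X ∪e d} {f = f} inv
    (λ d' n → flat-edge f d e d' (changed-edge X d {d'} (λ e → n (sym e))))

  -- The 𝔽₂-valued 1-form x on X evaluated on the boundary of the union of the faces where f is true
  pairing : Edges → (Fin nE → Bool) → (Dart nE → Bool) → Bool
  pairing X x f = sum λ e → X e ∧ (x e ∧ ∂ f e)

  Closed : Edges → (Fin nE → Bool) → Set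
  Closed X x = ∀ f → Invariant X f → pairing X x f ≡ false

  Primitive : Edges → (Fin nE → Bool) → Verts → Set
  Primitive X x v = ∀ e → X e ≡ true → x e ≡ δ v e

  pairing-cong : ∀ {X Y x y f g} → (∀ e → X e ∧ (x e ∧ ∂ f e) ≡ Y e ∧ (y e ∧ ∂ g e))
    → pairing X x f ≡ pairing Y y g
  pairing-cong = sum-cong-≗

  pairing-add : ∀ X x f d → X (proj₁ d) ≡ false
    → pairing (X ∪e d) x f ≡ pairing X x f xor (x (proj₁ d) ∧ (f d xor f (flipD d)))
  pairing-add X x f d new = trans
    (sum-change (proj₁ d) (cong (_∧ _) new) λ {e} ne → cong (_∧ (x e ∧ ∂ f e)) (insert-other _ X ne))
    (cong (pairing X x f xor_) (trans (cong (_∧ _) (insert-new _ X)) (cong (x (proj₁ d) ∧_) (∂-dart f d))))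

  pairing-xorˡ : ∀ X x y f → pairing X (λ e → x e xor y e) f ≡ pairing X x f xor pairing X y f
  pairing-xorˡ X x y f = trans (sum-cong-≗ (λ e → distrib (X e) (x e) (y e) (∂ f e)))
    (∑-distrib-+ (λ e → X e ∧ (x e ∧ ∂ f e)) (λ e → X e ∧ (y e ∧ ∂ f e)))
    where
    distrib : ∀ a b c d → a ∧ ((b xor c) ∧ d) ≡ (a ∧ (b ∧ d)) xor (a ∧ (c ∧ d))
    distrib a b c d = trans (cong (a ∧_) (Boolₚ.∧-distribʳ-xor d b c)) (Boolₚ.∧-distribˡ-xor a _ _)

  pairing-xorʳ : ∀ X x f g → pairing X x (λ d → f d xor g d) ≡ pairing X x f xor pairing X x g
  pairing-xorʳ X x f g = trans (sum-cong-≗ (λ e → distrib (X e) (x e) (f (e , false)) (g (e , false)) _ _))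
    (∑-distrib-+ (λ e → X e ∧ (x e ∧ ∂ f e)) (λ e → X e ∧ (x e ∧ ∂ g e)))
    where
    distrib : ∀ p q a b c d → p ∧ (q ∧ ((a xor b) xor (c xor d))) ≡ (p ∧ (q ∧ (a xor c))) xor (p ∧ (q ∧ (b xor d)))
    distrib p q a b c d = trans (cong (λ z → p ∧ (q ∧ z)) (xor-medial a b c d))
      (trans (cong (p ∧_) (Boolₚ.∧-distribˡ-xor q _ _)) (Boolₚ.∧-distribˡ-xor p _ _))

  pairing-zero : ∀ {X x} f → (∀ e → X e ≡ true → x e ≡ false) → pairing X x f ≡ false
  pairing-zero {X} {x} f z = sum-false λ e → vanish e (X e) refl
    where
    vanish : ∀ e b → X e ≡ b → b ∧ (x e ∧ ∂ f e) ≡ false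
    vanish e false eq = refl
    vanish e true  eq = cong (_∧ _) (z e eq)

  -- Summation by parts around the vertices: for invariant f, f (flipD d) = f (rot d) when d lies
  -- in X, so the sum telescopes along rot.
  δ-closed : ∀ X v → Closed X (δ v)
  δ-closed X v f inv = begin
    pairing X (δ v) f                     ≡⟨ sum-cong-≗ term ⟩
    sum (λ e → u (e , false) xor u (e , true))
      ≡⟨ sum-cong-≗ (λ e → regroup (v (end (e , false))) (v (end (e , true))) (f (e , false)) _ (f (e , true)) _) ⟩
    sum (λ e → (w (e , false) xor w (e , true)) xor (w' (e , false) xor w' (e , true)))
      ≡⟨ ∑-distrib-+ (λ e → w (e , false) xor w (e , true)) (λ e → w' (e , false) xor w' (e , true)) ⟩
    dartSum w xor dartSum w'              ≡⟨ cong (dartSum w xor_) (sum-cong-≗ λ e → cong₂ _xor_ (shift (e , false)) (shift (e , true))) ⟩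
    dartSum w xor dartSum (w ∘ rot)       ≡⟨ cong (dartSum w xor_) (dartSum-permute rot rot⁻ rot-inv₁ rot-inv₂ w) ⟩
    dartSum w xor dartSum w               ≡⟨ Boolₚ.xor-same (dartSum w) ⟩
    false                                 ∎
    where
    open ≡-Reasoning
    u w w' : Dart nE → Bool
    u d = v (end d) ∧ (f d xor f (rot d))
    w d = v (end d) ∧ f d
    w' d = v (end d) ∧ f (rot d)
    shift : ∀ d → w' d ≡ w (rot d)
    shift d = cong (λ z → v z ∧ f (rot d)) (sym (rot-end d))
    regroup : ∀ a b p p' q q' → (a ∧ (p xor p')) xor (b ∧ (q xor q'))
      ≡ ((a ∧ p) xor (b ∧ q)) xor ((a ∧ p') xor (b ∧ q'))
    regroup false false p p' q q' = refl
    regroup false true  p p' q q' = refl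
    regroup true  false p p' q q' = trans (Boolₚ.xor-identityʳ _) (sym (cong₂ _xor_ (Boolₚ.xor-identityʳ p) (Boolₚ.xor-identityʳ p')))
    regroup true  true  p p' q q' = xor-medial p p' q q'
    fold : ∀ a b p q → (a xor b) ∧ (p xor q) ≡ (a ∧ (p xor q)) xor (b ∧ (q xor p))
    fold a b p q = trans (Boolₚ.∧-distribʳ-xor (p xor q) a b) (cong (λ z → (a ∧ (p xor q)) xor (b ∧ z)) (Boolₚ.xor-comm p q))
    turn : ∀ d → X (proj₁ d) ≡ true → f (rot d) ≡ f (flipD d)
    turn d eq = trans (cong (f ∘ rot) (sym (flip-involutive d)))
      (trans (cong f (sym (trace-in X {flipD d} eq))) (inv (flipD d)))
    stay : ∀ d → X (proj₁ d) ≡ false → u d ≡ false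
    stay d eq = trans (cong (λ z → v (end d) ∧ (f d xor z)) (trans (cong f (sym (trace-out X {d} eq))) (inv d)))
      (trans (cong (v (end d) ∧_) (Boolₚ.xor-same (f d))) (Boolₚ.∧-zeroʳ _))
    term : ∀ e → X e ∧ (δ v e ∧ ∂ f e) ≡ u (e , false) xor u (e , true)
    term e = cases (X e) refl
      where
      cases : ∀ b → X e ≡ b → b ∧ (δ v e ∧ ∂ f e) ≡ u (e , false) xor u (e , true)
      cases true  eq = trans (fold (v (end (e , false))) (v (end (e , true))) (f (e , false)) (f (e , true)))
        (cong₂ (λ p q → (v (end (e , false)) ∧ (f (e , false) xor p)) xor (v (end (e , true)) ∧ (f (e , true) xor q)))
          (sym (turn (e , false) eq)) (sym (turn (e , true) eq)))
      cases false eq = sym (cong₂ _xor_ (stay (e , false) eq) (stay (e , true) eq))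

  -- The witness is the indicator of the new face at `d`; by `cut`, `flipD d` lies in the other new
  -- face.
  separating : ∀ X d → X (proj₁ d) ≡ false → SameFace X d (flipD d)
    → ∃[ f ] (Invariant (X ∪e d) f × f d xor f (flipD d) ≡ true)
  separating X d new same = f , inv
    , trans (cong (_xor f (flipD d)) (dec-true (sameFace? X⁺ d d) orb-refl))
            (cong not (dec-false (sameFace? X⁺ d (flipD d)) (Toggle.Add.cut X d new same)))
    where
    X⁺ = X ∪e d
    f : Dart nE → Bool
    f d' = does (sameFace? X⁺ d d')
    inv : Invariant X⁺ f
    inv d' = does-⇔ (mk⇔ (λ s → orb-trans s (faceEq-sym X⁺ orb-step)) (λ s → orb-trans s orb-step))
      (sameFace? X⁺ d (trace X⁺ d')) (sameFace? X⁺ d d')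

  -- After the merge both darts of the edge lie in one face, so the edge contributes nothing to any
  -- pairing, whatever value `x` takes on it. This freedom lets a form be 1 on a crossing edge.
  closed-join : ∀ {X x} d → X (proj₁ d) ≡ false → ¬ SameFace X d (flipD d) → Closed X x → Closed (X ∪e d) x
  closed-join {X} {x} d new apart cl f inv = trans (pairing-add X x f d new)
    (cong₂ _xor_ (cl f (invariant-remove {X} {f} d inv eq))
      (trans (cong (x (proj₁ d) ∧_) (trans (cong (_xor f (flipD d)) eq) (Boolₚ.xor-same (f (flipD d))))) (Boolₚ.∧-zeroʳ (x (proj₁ d)))))
    where
    eq : f d ≡ f (flipD d)
    eq = invariant-orb {X ∪e d} {f} inv (Toggle.Add.joined X d new apart)

  -- Here one new condition appears, from the colouring `f₀` that separates the two halves. An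
  -- invariant colouring that differs across the new edge becomes flat there after adding `f₀`, and
  -- flat colourings are covered by closedness on `X`.
  closed-split : ∀ {X x} d → X (proj₁ d) ≡ false → SameFace X d (flipD d) → Closed X x
    → ∃[ x' ] (Closed (X ∪e d) x' × (∀ e → X e ≡ true → x' e ≡ x e))
  closed-split {X} {x} d new same cl with separating X d new same
  ... | f₀ , inv₀ , sep = x' , closed , old
    where
    e₀ = proj₁ d
    -- The only value that makes the pairing with `f₀` vanish: the new edge enters that sum with
    -- coefficient 1.
    s = pairing X x f₀
    x' : Fin nE → Bool
    x' e = if does (e Finₚ.≟ e₀) then s else x e
    old : ∀ e → X e ≡ true → x' e ≡ x e
    old e Xe with e Finₚ.≟ e₀
    ... | yes refl = ⊥-elim (true≢false Xe new)
    ... | no _     = refl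
    x'-e₀ : x' e₀ ≡ s
    x'-e₀ = cong (λ b → if b then s else x e₀) (dec-true (e₀ Finₚ.≟ e₀) refl)
    agree : ∀ f → pairing X x' f ≡ pairing X x f
    agree f = pairing-cong {X} {X} {x'} {x} {f} {f} λ e → term e (X e) refl
      where
      term : ∀ e b → X e ≡ b → b ∧ (x' e ∧ ∂ f e) ≡ b ∧ (x e ∧ ∂ f e)
      term e false eq = refl
      term e true  eq = cong (_∧ ∂ f e) (old e eq)
    expand : ∀ f → pairing (X ∪e d) x' f ≡ pairing X x f xor (s ∧ (f d xor f (flipD d)))
    expand f = trans (pairing-add X x' f d new)
      (cong₂ _xor_ (agree f) (cong (_∧ (f d xor f (flipD d))) x'-e₀))
    at-f₀ : pairing (X ∪e d) x' f₀ ≡ false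
    at-f₀ = trans (expand f₀) (trans (cong (λ b → s xor (s ∧ b)) sep)
      (trans (cong (s xor_) (Boolₚ.∧-identityʳ s)) (Boolₚ.xor-same s)))
    flat : ∀ f → Invariant (X ∪e d) f → f d xor f (flipD d) ≡ false → pairing (X ∪e d) x' f ≡ false
    flat f inv eq = trans (expand f) (trans (cong (λ b → pairing X x f xor (s ∧ b)) eq)
      (trans (cong (pairing X x f xor_) (Boolₚ.∧-zeroʳ s)) (trans (Boolₚ.xor-identityʳ _)
        (cl f (invariant-remove {X} {f} d inv (xor-≡ _ _ eq))))))
    closed : Closed (X ∪e d) x'
    closed f inv = cases (f d xor f (flipD d)) refl
      where
      cases : ∀ b → f d xor f (flipD d) ≡ b → pairing (X ∪e d) x' f ≡ false
      cases false eq = flat f inv eq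
      cases true  eq = begin
        pairing (X ∪e d) x' f                                  ≡⟨ Boolₚ.xor-identityʳ _ ⟨
        pairing (X ∪e d) x' f xor false                        ≡⟨ cong (pairing (X ∪e d) x' f xor_) at-f₀ ⟨
        pairing (X ∪e d) x' f xor pairing (X ∪e d) x' f₀       ≡⟨ pairing-xorʳ (X ∪e d) x' f f₀ ⟨
        pairing (X ∪e d) x' (λ d → f d xor f₀ d)
          ≡⟨ flat _ (invariant-xor {X ∪e d} {f} {f₀} inv inv₀) (trans (xor-medial (f d) (f₀ d) _ _) (cong₂ _xor_ eq sep)) ⟩
        false ∎
        where
        open ≡-Reasoning

  -- The faces of X, seen as subsets of the surface, extend to unions of faces of Y: each
  -- component of Y minus X lies in a single face of X.
  Extends : Edges → Verts → Edges → Set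
  Extends X W Y = ∀ f → Invariant X f → ∃[ g ] (Invariant X g × (∀ d → W (end d) ≡ true → g d ≡ f d)
    × (∀ d → X (proj₁ d) ≡ false → Y (proj₁ d) ≡ true → g d ≡ g (flipD d)))

  extends-step : ∀ {X W W⁺ Y} d → X (proj₁ d) ≡ false → (∀ u → W u ≡ true → W⁺ u ≡ true)
    → W⁺ (end d) ≡ true → W⁺ (end (flipD d)) ≡ true
    → (∀ f → Invariant X f → ∃[ g ] (Invariant X g × (∀ d → W (end d) ≡ true → g d ≡ f d) × g d ≡ g (flipD d)))
    → Extends (X ∪e d) W⁺ Y → Extends X W Y
  extends-step {X} {W} {W⁺} {Y} d new W⊆ wd wd' first rest f inv =
    let g , inv-g , g≡f , flat-g = first f inv
        h , inv-h , h≡g , flat-h = rest g (invariant-add {X} {g} d inv-g flat-g)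
        flat : h d ≡ h (flipD d)
        flat = trans (h≡g d wd) (trans flat-g (sym (h≡g (flipD d) wd')))
        sym-h : ∀ d' → X (proj₁ d') ≡ false → Y (proj₁ d') ≡ true → h d' ≡ h (flipD d')
        sym-h d' x y = [ (λ e → flat-edge h d flat d' e)
                       , (λ ne → flat-h d' (trans (insert-other _ X ne) x) y) ]′ (toSum (proj₁ d' Finₚ.≟ proj₁ d))
    in h , invariant-remove {X} {h} d inv-h flat
         , (λ d' w → trans (h≡g d' (W⊆ _ w)) (g≡f d' w)) , sym-h

  -- The new vertex lies inside the face at `d`, so all its darts receive the colour `f d`. No edge
  -- of `X` ends there, which keeps the recoloured function invariant.
  extends-leaf : ∀ {X W} d → Supported X W → W (end d) ≡ true → W (end (flipD d)) ≡ false
    → ∀ f → Invariant X f → ∃[ g ] (Invariant X g × (∀ d → W (end d) ≡ true → g d ≡ f d) × g d ≡ g (flipD d))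
  extends-leaf {X} {W} d sup old fresh f inv = g , inv-g , g≡f , flat
    where
    f' : Dart nE → Fin nV → Bool
    f' d' u = if does (u Finₚ.≟ end (flipD d)) then f d else f d'
    g : Dart nE → Bool
    g d' = f' d' (end d')
    kept : ∀ d' {u} → u ≢ end (flipD d) → f' d' u ≡ f d'
    kept d' ne = cong (λ b → if b then f d else f d') (dec-false (_ Finₚ.≟ _) ne)
    hit : ∀ d' {u} → u ≡ end (flipD d) → f' d' u ≡ f d
    hit d' e = cong (λ b → if b then f d else f d') (dec-true (_ Finₚ.≟ _) e)
    notFresh : ∀ {u} → W u ≡ true → u ≢ end (flipD d)
    notFresh w refl = true≢false w fresh
    g≡f : ∀ d' → W (end d') ≡ true → g d' ≡ f d'
    g≡f d' w = kept d' (notFresh w)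
    flat : g d ≡ g (flipD d)
    flat = trans (g≡f d old) (sym (hit (flipD d) refl))
    inv-g : Invariant X g
    inv-g d' = cases (X (proj₁ d')) refl (end d' Finₚ.≟ end (flipD d))
      where
      cases : ∀ b → X (proj₁ d') ≡ b → Dec (end d' ≡ end (flipD d)) → g (trace X d') ≡ g d'
      cases true  eq _ = trans (g≡f _ (supported-trace {X} {W} sup {inj₁ d'} (sup d' eq)))
        (trans (inv d') (sym (g≡f d' (sup d' eq))))
      cases false eq (yes e) = trans (hit (trace X d') (trans (trans (cong end (trace-out X eq)) (rot-end d')) e)) (sym (hit d' e))
      cases false eq (no ne) = trans (kept (trace X d') λ e → ne (trans (sym (trans (cong end (trace-out X eq)) (rot-end d'))) e))
        (trans (inv d') (sym (kept d' ne)))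

  chain-extends : ∀ {X W Y Z} → Supported X W → Chain Y Z X W 0 → Extends X W Y
  chain-extends sup (done eE _) f inv = f , inv , (λ _ _ → refl) , λ d x y → ⊥-elim (true≢false (trans (eE _) y) x)
  chain-extends {X} {W} sup (leaf d new y old fresh c) =
    extends-step {X} {W} {W ∪v flipD d} d new (λ _ → insert-old _ W) (insert-old _ W old) (insert-new _ W)
      (extends-leaf {X} {W} d sup old fresh) (chain-extends {X ∪e d} {W ∪v flipD d} (supported-leaf {X} {W} d sup old) c)
  chain-extends {X} {W} sup (split d new y old old' same c) =
    extends-step {X} {W} {W} d new (λ _ w → w) old old'
      (λ f inv → f , inv , (λ _ _ → refl) , invariant-orb {X} {f} inv same) (chain-extends {X ∪e d} {W} (supported-chord {X} {W} d sup old old') c)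

  -- Replace `f` by its extension `g`. The two agree along `X`, and `∂ g` is zero on the edges of
  -- `Y` outside `X`, so the two pairings are the same sum, while `g` is invariant for `Y`.
  closed-restrict : ∀ {X W Y x} → Supported X W → (∀ e → X e ≡ true → Y e ≡ true)
    → Extends X W Y → Closed Y x → Closed X x
  closed-restrict {X} {W} {Y} {x} sup X⊆Y ext cl f inv =
    let g , inv-g , g≡f , flat = ext f inv
        change : ∀ d → X (proj₁ d) ≢ Y (proj₁ d) → g d ≡ g (flipD d)
        change d ne = cases d (X (proj₁ d)) (Y (proj₁ d)) refl refl ne (flat d)
        term : ∀ e → X e ∧ (x e ∧ ∂ f e) ≡ Y e ∧ (x e ∧ ∂ g e)
        term e = terms e g g≡f (flat (e , false)) (X e) (Y e) refl refl
    in trans (pairing-cong {X} {Y} {x} {x} {f} {g} term) (cl g (invariant-change {X} {f = g} inv-g change))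
    where
    cases : ∀ d b c {A : Set} → X (proj₁ d) ≡ b → Y (proj₁ d) ≡ c → X (proj₁ d) ≢ Y (proj₁ d)
      → (X (proj₁ d) ≡ false → Y (proj₁ d) ≡ true → A) → A
    cases d false true  p q ne k = k p q
    cases d false false p q ne k = ⊥-elim (ne (trans p (sym q)))
    cases d true  c     p q ne k = ⊥-elim (ne (trans p (sym (X⊆Y _ p))))
    terms : ∀ e g → (∀ d → W (end d) ≡ true → g d ≡ f d)
      → (X e ≡ false → Y e ≡ true → g (e , false) ≡ g (e , true))
      → ∀ b c → X e ≡ b → Y e ≡ c → b ∧ (x e ∧ ∂ f e) ≡ c ∧ (x e ∧ ∂ g e)
    terms e g g≡f fl false false p q = refl
    terms e g g≡f fl false true  p q = sym (trans (cong (x e ∧_) (∂-flat g (e , false) (fl p q))) (Boolₚ.∧-zeroʳ (x e)))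
    terms e g g≡f fl true  false p q = ⊥-elim (true≢false (X⊆Y e p) q)
    terms e g g≡f fl true  true  p q = cong (x e ∧_)
      (sym (cong₂ _xor_ (g≡f (e , false) (sup (e , false) p)) (g≡f (e , true) (sup (e , true) p))))

  chain-closed : ∀ {X W Y Z x} → Supported X W → Chain Y Z X W 0 → Closed Y x → Closed X x
  chain-closed {X} {W} {x = x} sup c = closed-restrict {X} {W} {x = x} sup (chain-⊆ c) (chain-extends {X} {W} sup c)

  -- Extending primitives and closed forms along chains.

  primitive-add : ∀ {X x v} d → Primitive X x v → x (proj₁ d) ≡ v (end d) xor v (end (flipD d))
    → Primitive (X ∪e d) x v
  primitive-add {X} {x} {v} d prim eq e Xe with insert-elim _ X Xe
  ... | inj₁ old  = prim e old
  ... | inj₂ refl = trans eq (sym (∂-dart (v ∘ end) d))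

  -- The sum of `x` and `δ v` is closed and vanishes on `X`. Paired with a colouring that separates
  -- the sides of the new edge, it keeps only the term of that edge, so it vanishes there too.
  primitive-split : ∀ {X x v} d → X (proj₁ d) ≡ false → SameFace X d (flipD d) → Closed (X ∪e d) x
    → Primitive X x v → x (proj₁ d) ≡ v (end d) xor v (end (flipD d))
  primitive-split {X} {x} {v} d new same cl prim =
    let f , inv , sep = separating X d new same
        e = proj₁ d
        y : Fin nE → Bool
        y e = x e xor δ v e
        onX : pairing X y f ≡ false
        onX = pairing-zero {X} {y} f λ e Xe → trans (cong (_xor δ v e) (prim e Xe)) (Boolₚ.xor-same (δ v e))
        whole : pairing (X ∪e d) y f ≡ false
        whole = trans (pairing-xorˡ (X ∪e d) x (δ v) f) (cong₂ _xor_ (cl f inv) (δ-closed (X ∪e d) v f inv))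
        y-e : y e ≡ false
        y-e = begin
          y e                                               ≡⟨ Boolₚ.∧-identityʳ (y e) ⟨
          y e ∧ true                                        ≡⟨ cong (y e ∧_) sep ⟨
          y e ∧ (f d xor f (flipD d))                       ≡⟨ cong (_xor (y e ∧ (f d xor f (flipD d)))) onX ⟨
          pairing X y f xor (y e ∧ (f d xor f (flipD d)))   ≡⟨ pairing-add X y f d new ⟨
          pairing (X ∪e d) y f                              ≡⟨ whole ⟩
          false                                             ∎
    in trans (xor-≡ _ _ y-e) (∂-dart (v ∘ end) d)
    where open ≡-Reasoning

  -- At a leaf the value at the new vertex is free and is chosen to satisfy the equation on the new
  -- edge. At a split nothing is free, but closedness supplies the equation.
  chain-primitive : ∀ {X W Y Z x v} → Supported X W → Chain Y Z X W 0 → Closed Y x → Primitive X x v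
    → ∃[ v' ] (Primitive Y x v' × (∀ u → W u ≡ true → v' u ≡ v u))
  chain-primitive {v = v} sup (done eE _) cl prim = v , (λ e Ye → prim e (trans (eE e) Ye)) , λ _ _ → refl
  chain-primitive {X} {W} {x = x} {v} sup (leaf d new y old fresh c) cl prim =
    let v⁺ : Verts
        v⁺ u = if does (u Finₚ.≟ end (flipD d)) then v (end d) xor x (proj₁ d) else v u
        kept : ∀ u → W u ≡ true → v⁺ u ≡ v u
        kept u w = cong (λ b → if b then v (end d) xor x (proj₁ d) else v u)
          (dec-false (u Finₚ.≟ end (flipD d)) λ { refl → true≢false w fresh })
        hit : v⁺ (end (flipD d)) ≡ v (end d) xor x (proj₁ d)
        hit = cong (λ b → if b then v (end d) xor x (proj₁ d) else v (end (flipD d))) (dec-true (end (flipD d) Finₚ.≟ end (flipD d)) refl)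
        prim⁺ : Primitive X x v⁺
        prim⁺ e Xe = trans (prim e Xe)
          (sym (cong₂ _xor_ (kept _ (sup (e , false) Xe)) (kept _ (sup (e , true) Xe))))
        eq : x (proj₁ d) ≡ v⁺ (end d) xor v⁺ (end (flipD d))
        eq = sym (trans (cong₂ _xor_ (kept _ old) hit) (xor-cancelˡ (v (end d)) (x (proj₁ d))))
        v' , prim' , agree = chain-primitive {X ∪e d} {W ∪v flipD d} (supported-leaf {X} {W} d sup old) c cl (primitive-add {X} {x} {v⁺} d prim⁺ eq)
    in v' , prim' , λ u w → trans (agree u (insert-old _ W w)) (kept u w)
  chain-primitive {X} {W} {x = x} {v} sup (split d new y old old' same c) cl prim =
    let sup⁺ = supported-chord {X} {W} d sup old old' in
    chain-primitive {X ∪e d} {W} sup⁺ c cl (primitive-add {X} {x} {v} d prim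
      (primitive-split {X} {x} {v} d new same (chain-closed {X ∪e d} {W} {x = x} sup⁺ c cl) prim))

  -- A leaf merges two orbits, so `x` may stay as it is. A split dictates the value on its edge, and
  -- only that value is altered.
  chain-form : ∀ {X W Y Z x} → Supported X W → Chain Y Z X W 0 → Closed X x
    → ∃[ x' ] (Closed Y x' × (∀ e → X e ≡ true → x' e ≡ x e))
  chain-form {X} {W} {Y} {x = x} sup (done eE _) cl = x
    , (λ f inv → trans (pairing-cong {Y} {X} {x} {x} {f} {f} (λ e → cong (_∧ (x e ∧ ∂ f e)) (sym (eE e))))
                       (cl f (invariant-change {Y} {X} {f} inv λ d ne → ⊥-elim (ne (sym (eE _))))))
    , λ _ _ → refl
  chain-form {X} {W} {x = x} sup (leaf d new y old fresh c) cl =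
    let x' , cl' , agree = chain-form {X ∪e d} {W ∪v flipD d} {x = x} (supported-leaf {X} {W} d sup old) c
          (closed-join {X} {x} d new (leaf-separate {X} {W} sup old fresh) cl)
    in x' , cl' , λ e Xe → agree e (insert-old _ X Xe)
  chain-form {X} {W} {x = x} sup (split d new y old old' same c) cl =
    let x₁ , cl₁ , agree₁ = closed-split {X} {x} d new same cl
        x₂ , cl₂ , agree₂ = chain-form {X ∪e d} {W} {x = x₁} (supported-chord {X} {W} d sup old old') c cl₁
    in x₂ , cl₂ , λ e Xe → trans (agree₂ e (insert-old _ X Xe)) (agree₁ e Xe)

  -- 1 on the last edge joining two different faces; extended over the later edges to a closed form.
  obstruction : ∀ {X W Y Z q} → Supported X W → Chain Y Z X W (suc q)
    → ∃[ x ] (Closed Y x × (∀ e → X e ≡ true → x e ≡ false)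
             × (∀ v → (∀ u → W u ≡ true → v u ≡ false) → ¬ Primitive Y x v))
  obstruction {X} {W} sup (leaf d new y old fresh c) =
    let x , cl , zero-x , none = obstruction {X ∪e d} {W ∪v flipD d} (supported-leaf {X} {W} d sup old) c
        -- The form is zero on the leaf edge, so a primitive that vanishes at its old end vanishes
        -- at the new vertex as well.
        vanish : ∀ v → (∀ u → W u ≡ true → v u ≡ false) → Primitive _ x v → ∀ u → (W ∪v flipD d) u ≡ true → v u ≡ false
        vanish v zero-v prim u w = [ zero-v u , (λ { refl →
          trans (xor-solve {v (end d)} (trans (prim _ y) (∂-dart (v ∘ end) d)))
                (cong₂ _xor_ (zero-v _ old) (zero-x _ (insert-new _ X))) }) ]′ (insert-elim _ W w)
    in x , cl , (λ e Xe → zero-x e (insert-old _ X Xe)) , λ v zero-v prim → none v (vanish v zero-v prim) prim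
  obstruction {X} {W} sup (split d new y old old' same c) =
    let x , cl , zero-x , none = obstruction {X ∪e d} {W} (supported-chord {X} {W} d sup old old') c
    in x , cl , (λ e Xe → zero-x e (insert-old _ X Xe)) , none
  obstruction {X} {W} {q = suc q} sup (cross d new y old old' apart c) =
    let x , cl , zero-x , none = obstruction {X ∪e d} {W} (supported-chord {X} {W} d sup old old') c
    in x , cl , (λ e Xe → zero-x e (insert-old _ X Xe)) , none
  -- This is the last crossing edge. Both its ends lie in `W`, where the supposed primitive is zero,
  -- although the form is 1 on the edge.
  obstruction {X} {W} {q = zero} sup (cross d new y old old' apart c) =
    let e₀ = proj₁ d
        one : Fin nE → Bool
        one e = does (e Finₚ.≟ e₀)
        off : ∀ e → X e ≡ true → one e ≡ false
        off e Xe = dec-false (e Finₚ.≟ e₀) λ { refl → true≢false Xe new }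
        x , cl , agree = chain-form {X ∪e d} {W} {x = one} (supported-chord {X} {W} d sup old old') c (closed-join {X} {one} d new apart λ f _ → pairing-zero {X} {one} f off)
        x-e₀ : x e₀ ≡ true
        x-e₀ = trans (agree e₀ (insert-new _ X)) (dec-true (e₀ Finₚ.≟ e₀) refl)
    in x , cl , (λ e Xe → trans (agree e (insert-old _ X Xe)) (off e Xe))
         , λ v zero-v prim → true≢false (trans (sym (trans (prim e₀ y) (∂-dart (v ∘ end) d))) x-e₀)
             (cong₂ _xor_ (zero-v _ old) (zero-v _ old'))

-- Faces of the members of a family

∧-elim : ∀ {a b} → a ∧ b ≡ true → a ≡ true × b ≡ true
∧-elim {true} {true} refl = refl , refl

toℕ-code : ∀ {n} (d : Dart n) → toℕ (code d) ≡ rank d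
toℕ-code (zero  , false) = refl
toℕ-code (zero  , true)  = refl
toℕ-code (suc e , b)     = trans (cong (2 +_) (toℕ-code (e , b)))
  (cong (_+ (if b then 1 else 0)) (sym (ℕₚ.*-suc 2 (toℕ e))))

rank-injective : ∀ {n} {d d' : Dart n} → rank d ≡ rank d' → d ≡ d'
rank-injective e = code-injective (Finₚ.toℕ-injective (trans (toℕ-code _) (trans e (sym (toℕ-code _)))))

∈-allDarts : ∀ {n} (d : Dart n) → d ∈ₗ allDarts n
∈-allDarts (e , false) = ∈-concatMap⁺ _ (lose (∈-allFin e) (here refl))
∈-allDarts (e , true)  = ∈-concatMap⁺ _ (lose (∈-allFin e) (there (here refl)))

allDarts-unique : ∀ n → Unique (allDarts n)
allDarts-unique n = Uniqueₚ.concat⁺ (Allₚ.map⁺ (All.universal (λ e → ((λ ()) ∷ []) ∷ [] ∷ []) (allFin n)))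
  (AllPairsₚ.map⁺ (AllPairs.map (λ ne → λ
    { (here refl , here refl) → ne refl
    ; (here refl , there (here ()))
    ; (there (here refl) , there (here refl)) → ne refl }) (Uniqueₚ.allFin⁺ n)))

module Members (G : EmbeddedGraph) {k : ℕ} (F : Family G k) where
  open EmbeddedGraph G
  open Family F
  open Surface G

  _∋_ : Subset k → Fin k → Set
  S ∋ i = lookup S i ≡ true

  edges : Subset k → Edges
  edges S = Union.inE G F S

  verts : Subset k → Verts
  verts S = Union.inV G F S

  verts-intro : ∀ S i {u} → S ∋ i → vert i u ≡ true → verts S u ≡ true
  verts-intro S i Si iu = T⇒≡ (Anyₚ.any⁺ _ (lose (∈-allFin i) (≡⇒T (cong₂ _∧_ Si iu))))

  verts-elim : ∀ S {u} → verts S u ≡ true → ∃[ i ] (S ∋ i × vert i u ≡ true)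
  verts-elim S {u} e =
    let i , _ , t = find (Anyₚ.any⁻ (λ i → lookup S i ∧ vert i u) (allFin k) (≡⇒T e)) in i , ∧-elim (T⇒≡ t)

  supported : ∀ S → Supported (edges S) (verts S)
  supported S d e = verts-intro S (edgeOf (proj₁ d)) e (end-in d)

  At : Fin nV → Item → Set
  At u (inj₁ d)  = end d ≡ u
  At u (inj₂ u') = u' ≡ u × (∀ d → end d ≢ u)

  at-unique : ∀ {u u'} i → At u i → At u' i → u ≡ u'
  at-unique (inj₁ d) refl refl = refl
  at-unique (inj₂ w) (refl , _) (refl , _) = refl

  at-within : ∀ {W : Verts} {u} i → At u i → W u ≡ true → Within W i
  at-within (inj₁ d) refl       w = w
  at-within (inj₂ _) (refl , z) w = w , z

  within-at : ∀ {W : Verts} i → Within W i → ∃[ u ] (At u i × W u ≡ true)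
  within-at (inj₁ d) w       = end d , refl , w
  within-at (inj₂ u) (w , z) = u , (refl , z) , w

  locate : ∀ u → ∃[ i ] At u i
  locate u with any-dart? (λ d → end d Finₚ.≟ u)
  ... | yes (d , e) = inj₁ d , e
  ... | no none     = inj₂ u , refl , λ d e → none (d , e)

  at-untouched : ∀ {X u} → Untouched X u → ∀ {i j} → FaceEq X i j → At u i → At u j
  at-untouched {X} {u} unt = orb-preserves (At u) λ {i} → next i
    where
    next : ∀ i → At u i → At u (traceI X i)
    next (inj₁ d) e = trans (cong end (trace-out X (unt d e))) (trans (rot-end d) e)
    next (inj₂ w) e = e

  at-same : ∀ {X u} → Untouched X u → ∀ i j → At u i → At u j → FaceEq X i j
  at-same unt (inj₁ d) (inj₁ d')       e          e'         = untouched-same unt d d' e e'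
  at-same unt (inj₁ d) (inj₂ _)        e          (_ , none) = ⊥-elim (none d e)
  at-same unt (inj₂ _) (inj₁ d)        (_ , none) e          = ⊥-elim (none d e)
  at-same unt (inj₂ _) (inj₂ _)        (refl , _) (refl , _) = orb-refl

  module FaceCount (S : Subset k) where
    open Union G F S

    orb-lift : ∀ {d d'} → Orb (trace inE) d d' → SameFace inE d d'
    orb-lift {d} o = orb-preserves (SameFace inE d) (λ s → orb-trans s orb-step) o orb-refl

    orb-lower : ∀ {d d'} → SameFace inE d d' → Orb (trace inE) d d'
    orb-lower {d} o = orb-preserves Q (λ {i} → next i) o orb-refl
      where
      Q : Item → Set
      Q (inj₁ d') = Orb (trace inE) d d'
      Q (inj₂ _)  = ⊥
      next : ∀ i → Q i → Q (traceI inE i)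
      next (inj₁ d') o = orb-trans o orb-step

    -- The last clause says that no dart of the union is skipped between `rot z` and `w`. Its
    -- inequality of step counts drives the descent in `trace⇒φ`.
    Next : Dart nE → Dart nE → Set
    Next z w = inD w ≡ true × Orb (trace inE) (rot z) w
      × (∀ j {y} → inD y ≡ true → iter (trace inE) j (rot z) ≡ y → ∃[ j' ] (j' ≤ j × iter (trace inE) j' w ≡ y))

    -- On darts outside the union, `trace` is `rot`, so the search of `nextIn` runs along a
    -- `trace`-orbit.
    nextIn-spec : ∀ n z i → i < n → inD (iter rot i (rot z)) ≡ true → Next z (nextIn inD rot n z)
    nextIn-spec (suc n) z i i<n found = cases (inD (rot z)) refl i i<n found
      where
      cases : ∀ b → inD (rot z) ≡ b → ∀ i → i < suc n → inD (iter rot i (rot z)) ≡ true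
        → Next z (if b then rot z else nextIn inD rot n (rot z))
      cases true  eq i i<n found = eq , orb-refl , λ j _ e → j , ℕₚ.≤-refl , e
      cases false eq zero i<n found = ⊥-elim (true≢false found eq)
      cases false eq (suc i) (s≤s i<n) found =
        let w∈ , o , back = nextIn-spec n (rot z) i i<n (trans (cong inD (iter-suc rot i (rot z))) found)
        in w∈ , orb-trans (1 , trace-out inE eq) o , λ
          { zero    y∈ refl → ⊥-elim (true≢false y∈ eq)
          ; (suc j) y∈ e    →
              let j' , j'≤j , e' = back j y∈ (trans (cong (iter (trace inE) j) (sym (trace-out inE eq)))
                                     (trans (iter-suc (trace inE) j (rot z)) e))
              in j' , ℕₚ.m≤n⇒m≤1+n j'≤j , e' }

    module FD = Finite {Dart nE} {nE * 2} code code-injective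

    φ-spec : ∀ d → inD d ≡ true → Next (flipD d) (φ d)
    φ-spec d d∈ = let p , p<N , e = FD.period rot-injective (flipD d) in
      -- The rotation returns to `flipD d`, a dart of the union, after fewer turns than the fuel in
      -- `rotS`; at the latest the search stops there.
      nextIn-spec (2 * nE) (flipD d) p (subst (p <_) (ℕₚ.*-comm nE 2) p<N) (trans (cong inD e) d∈)

    φ⇒trace : ∀ {d d'} → inD d ≡ true → Orb φ d d' → inD d' ≡ true × Orb (trace inE) d d'
    φ⇒trace {d} d∈ o = orb-preserves (λ d' → inD d' ≡ true × Orb (trace inE) d d')
      (λ {x} (x∈ , o) → let y∈ , o' , _ = φ-spec x x∈ in
        y∈ , orb-trans o (orb-trans (1 , trace-in inE x∈) o')) o (d∈ , orb-refl)

    trace⇒φ : ∀ {d d'} → inD d ≡ true → inD d' ≡ true → Orb (trace inE) d d' → Orb φ d d'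
    trace⇒φ {d} {d'} d∈ d'∈ (j , e) = go j j d ℕₚ.≤-refl d∈ e
      where
      go : ∀ k j d → j ≤ k → inD d ≡ true → iter (trace inE) j d ≡ d' → Orb φ d d'
      go k       zero    d _       d∈ refl = orb-refl
      go (suc k) (suc j) d (s≤s l) d∈ e =
        let w∈ , _ , back = φ-spec d d∈
            j' , j'≤j , e' = back j d'∈ (trans (cong (iter (trace inE) j) (sym (trace-in inE d∈)))
                               (trans (iter-suc (trace inE) j d) e))
        in orb-trans orb-step (go k j' (φ d) (ℕₚ.≤-trans j'≤j l) w∈ e')

    isRep-min : ∀ {d} → isRep d ≡ true → inD d ≡ true × (∀ {d'} → Orb φ d d' → rank d ≤ rank d')
    isRep-min {d} e = let d∈ , a = ∧-elim e in d∈ , λ { {d'} (j , refl) →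
      -- `isRep` inspects only the iterates up to `2 * nE`; by `shorten` these exhaust the orbit.
      let j' , j'≤N , eq = FD.shorten φ d j
          least = All.lookup (Allₚ.all⁺ (λ j → rank d ≤ᵇ rank (iter φ j d)) (upTo (suc (2 * nE))) (≡⇒T a))
                    (∈-upTo⁺ {suc (2 * nE)} (s≤s (subst (j' ≤_) (ℕₚ.*-comm nE 2) j'≤N)))
      in subst (λ x → rank d ≤ rank x) eq (ℕₚ.≤ᵇ⇒≤ _ _ least) }

    isRep-or-smaller : ∀ d → inD d ≡ true → isRep d ≡ true ⊎ (∃[ d' ] (Orb φ d d' × rank d' < rank d))
    isRep-or-smaller d d∈ = [ (λ al → inj₁ (cong₂ _∧_ d∈
          (T⇒≡ (Allₚ.all⁻ (λ j → rank d ≤ᵇ rank (iter φ j d)) (All.map ℕₚ.≤⇒≤ᵇ al)))))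
      , (λ na → let j , _ , n = find (Allₚ.¬All⇒Any¬ (λ j → rank d ≤? rank (iter φ j d)) _ na)
                in inj₂ (iter φ j d , (j , refl) , ℕₚ.≰⇒> n)) ]′
      (toSum (All.all? (λ j → rank d ≤? rank (iter φ j d)) (upTo (suc (2 * nE)))))

    rep : ∀ n d → rank d ≤ n → inD d ≡ true → ∃[ r ] (isRep r ≡ true × Orb φ d r)
    rep n d le d∈ with isRep-or-smaller d d∈
    ... | inj₁ e = d , e , orb-refl
    rep zero    d le d∈ | inj₂ (d' , o , lt) = ⊥-elim (ℕₚ.n≮0 (ℕₚ.≤-trans lt le))
    rep (suc n) d le d∈ | inj₂ (d' , o , lt) =
      let r , e , o' = rep n d' (s≤s⁻¹ (ℕₚ.≤-trans lt le)) (proj₁ (φ⇒trace d∈ o)) in r , e , orb-trans o o'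

    touches : Fin nV → Dart nE → Bool
    touches u d = inD d ∧ (toℕ (end d) ≡ᵇ toℕ u)

    isolated-elim : ∀ {u} → isolated u ≡ true → inV u ≡ true × Untouched inE u
    isolated-elim {u} e = let u∈ , n = ∧-elim e in u∈ , λ d eq → decide d eq n (inD d) refl
      where
      decide : ∀ d → end d ≡ u → not (any (touches u) (allDarts nE)) ≡ true → ∀ b → inD d ≡ b → b ≡ false
      decide d eq n false p = refl
      decide d eq n true  p = ⊥-elim (true≢false n (cong not (T⇒≡ (Anyₚ.any⁺ (touches u)
        (lose (∈-allDarts d) (≡⇒T (cong₂ _∧_ p (T⇒≡ (ℕₚ.≡⇒≡ᵇ _ _ (cong toℕ eq))))))))))

    isolated-intro : ∀ {u} → inV u ≡ true → Untouched inE u → isolated u ≡ true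
    isolated-intro {u} u∈ unt = cong₂ _∧_ u∈ (decide (any (touches u) (allDarts nE)) refl)
      where
      decide : ∀ b → any (touches u) (allDarts nE) ≡ b → not b ≡ true
      decide false p = refl
      decide true  p = let d , _ , t = find (Anyₚ.any⁻ (touches u) (allDarts nE) (≡⇒T p))
                           d∈ , e = ∧-elim (T⇒≡ t)
        in ⊥-elim (true≢false d∈ (unt d (Finₚ.toℕ-injective (ℕₚ.≡ᵇ⇒≡ _ _ (≡⇒T e)))))

    repDarts : List (Dart nE)
    repDarts = filter (λ d → T? (isRep d)) (allDarts nE)

    isolatedVerts : List (Fin nV)
    isolatedVerts = filter (λ u → T? (isolated u)) (allFin nV)

    -- A vertex isolated in the union may still carry darts of `G`, and its trivial face is then
    -- their orbit. The vertex item is taken only at degree 0 in `G`.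
    site : Fin nV → Item
    site u = proj₁ (locate u)

    faceList : List Item
    faceList = map inj₁ repDarts ++ map site isolatedVerts

    faceList-length : length faceList ≡ #F
    faceList-length = trans (Listₚ.length-++ (map inj₁ repDarts))
      (cong₂ _+_ (Listₚ.length-map inj₁ repDarts) (Listₚ.length-map site isolatedVerts))

    repDarts-sound : All (λ d → isRep d ≡ true) repDarts
    repDarts-sound = All.tabulate λ i → T⇒≡ (proj₂ (∈-filter⁻ (λ d → T? (isRep d)) {xs = allDarts nE} i))

    isolatedVerts-sound : All (λ u → isolated u ≡ true) isolatedVerts
    isolatedVerts-sound = All.tabulate λ i → T⇒≡ (proj₂ (∈-filter⁻ (λ u → T? (isolated u)) {xs = allFin nV} i))

    isolated⇒≁ : ∀ {u} → isolated u ≡ true → ∀ i → FaceEq inE (site u) i → At u i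
    isolated⇒≁ {u} e i o = at-untouched (proj₂ (isolated-elim e)) o (proj₂ (locate u))

    reach-edge : ∀ i d → inD (iter rot i d) ≡ true → ∃[ x ] (inD x ≡ true × SameFace inE d x)
    reach-edge i d e = go (inD d) refl i e
      where
      go : ∀ b → inD d ≡ b → ∀ i → inD (iter rot i d) ≡ true → ∃[ x ] (inD x ≡ true × SameFace inE d x)
      go true  eq i       e = d , eq , orb-refl
      go false eq zero    e = ⊥-elim (true≢false e eq)
      go false eq (suc i) e = let x , x∈ , s = reach-edge i (rot d) (trans (cong inD (iter-suc rot i d)) e)
        in x , x∈ , orb-trans (1 , cong inj₁ (trace-out inE eq)) s

    faceList-complete : ∀ i → Within inV i → ∃[ x ] (x ∈ₗ faceList × FaceEq inE x i)
    faceList-complete i w = let u , at , u∈ = within-at i w in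
      go u at u∈ (any-dart? (λ d → (end d Finₚ.≟ u) ×-dec (inD d Boolₚ.≟ true)))
      where
      go : ∀ u → At u i → inV u ≡ true → Dec (∃[ d ] (end d ≡ u × inD d ≡ true)) → ∃[ x ] (x ∈ₗ faceList × FaceEq inE x i)
      go u at u∈ (no none) = site u
        , ∈-++⁺ʳ (map inj₁ repDarts) (∈-map⁺ site (∈-filter⁺ (λ u → T? (isolated u)) (∈-allFin u) (≡⇒T (isolated-intro u∈ unt))))
        , at-same unt (site u) i (proj₂ (locate u)) at
        where
        unt : Untouched inE u
        unt d e = Boolₚ.¬-not (λ d∈ → none (d , e , d∈))
      go u at u∈ (yes (d , e , d∈)) = dart i at
        where
        dart : ∀ i → At u i → ∃[ x ] (x ∈ₗ faceList × FaceEq inE x i)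
        dart (inj₂ _)  (_ , none) = ⊥-elim (none d e)
        dart (inj₁ d') e' =
          let j , eq = rot-cyclic d' d (trans e' (sym e))
              x , x∈ , s = reach-edge j d' (trans (cong inD eq) d∈)
              r , r-rep , o = rep (rank x) x ℕₚ.≤-refl x∈
          in inj₁ r , ∈-++⁺ˡ (∈-map⁺ inj₁ (∈-filter⁺ (λ d → T? (isRep d)) (∈-allDarts r) (≡⇒T r-rep)))
             , faceEq-sym inE (orb-trans s (orb-lift (proj₂ (φ⇒trace x∈ o))))

    -- The bridge between `#F`, which counts minimal darts of `φ`-orbits and isolated vertices, and
    -- the orbits of `trace` that enter `euler`.
    faceList-reps : FaceReps inE inV faceList
    faceList-reps = record
      { sound = Allₚ.++⁺
          (Allₚ.map⁺ (All.map (λ {d} e → supported S d (proj₁ (isRep-min e))) repDarts-sound))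
          (Allₚ.map⁺ (All.map (λ {u} e → at-within (site u) (proj₂ (locate u)) (proj₁ (isolated-elim e))) isolatedVerts-sound))
      ; separate = AllPairsₚ.++⁺
          (AllPairsₚ.map⁺ (allPairs-refine reps-apart repDarts-sound
            (Uniqueₚ.filter⁺ (λ d → T? (isRep d)) (allDarts-unique nE))))
          (AllPairsₚ.map⁺ (allPairs-refine sites-apart isolatedVerts-sound
            (Uniqueₚ.filter⁺ (λ u → T? (isolated u)) (Uniqueₚ.allFin⁺ nV))))
          (Allₚ.map⁺ (All.map (λ {d} r → Allₚ.map⁺ (All.map (λ {u} → mixed-apart d u r) isolatedVerts-sound)) repDarts-sound))
      ; complete = λ {i} → faceList-complete i }
      where
      reps-apart : ∀ {d d'} → isRep d ≡ true → isRep d' ≡ true → d ≢ d' → ¬ SameFace inE d d'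
      reps-apart r r' ne s =
        let d∈ , least = isRep-min r ; d'∈ , least' = isRep-min r' in
        ne (rank-injective (ℕₚ.≤-antisym (least (trace⇒φ d∈ d'∈ (orb-lower s)))
                                         (least' (trace⇒φ d'∈ d∈ (orb-lower (faceEq-sym inE s))))))
      sites-apart : ∀ {u u'} → isolated u ≡ true → isolated u' ≡ true → u ≢ u' → ¬ FaceEq inE (site u) (site u')
      sites-apart {u} {u'} e e' ne s = ne (at-unique (site u') (isolated⇒≁ e (site u') s) (proj₂ (locate u')))
      mixed-apart : ∀ d u → isRep d ≡ true → isolated u ≡ true → ¬ FaceEq inE (inj₁ d) (site u)
      mixed-apart d u r e s = true≢false (proj₁ (isRep-min r))
        (proj₂ (isolated-elim e) d (isolated⇒≁ e (inj₁ d) (faceEq-sym inE s)))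

-- Gluing over the members of a cluster

∣∪∣≤ : ∀ {n} (p q : Subset n) → ∣ p ∪ q ∣ ≤ ∣ p ∣ + ∣ q ∣
∣∪∣≤ []            []            = z≤n
∣∪∣≤ (outside ∷ p) (outside ∷ q) = ∣∪∣≤ p q
∣∪∣≤ (outside ∷ p) (inside  ∷ q) = ℕₚ.≤-trans (s≤s (∣∪∣≤ p q)) (ℕₚ.≤-reflexive (sym (ℕₚ.+-suc ∣ p ∣ ∣ q ∣)))
∣∪∣≤ (inside  ∷ p) (outside ∷ q) = s≤s (∣∪∣≤ p q)
∣∪∣≤ (inside  ∷ p) (inside  ∷ q) = s≤s (ℕₚ.≤-trans (∣∪∣≤ p q) (ℕₚ.+-monoʳ-≤ ∣ p ∣ (ℕₚ.n≤1+n ∣ q ∣)))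

∣∪⁅⁆∣≤ : ∀ {n m} (p : Subset n) (i : Fin n) → ∣ p ∣ ≤ m → ∣ p ∪ ⁅ i ⁆ ∣ ≤ suc m
∣∪⁅⁆∣≤ {m = m} p i le = ℕₚ.≤-trans (∣∪∣≤ p ⁅ i ⁆)
  (ℕₚ.≤-trans (ℕₚ.≤-reflexive (trans (cong (∣ p ∣ +_) (∣⁅x⁆∣≡1 i)) (ℕₚ.+-comm ∣ p ∣ 1))) (s≤s le))

module Cluster (G : EmbeddedGraph) {k : ℕ} (F : Family G k) (a : Fin k) (cluster : IsCluster G F a) where
  open EmbeddedGraph G
  open Family F
  open Surface G
  open Forms G
  open Members G F

  ∋⇒∈ : ∀ {S i} → S ∋ i → i ∈ S
  ∋⇒∈ {S} {i} = lookup⇒[]= i S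

  ∈⇒∋ : ∀ {S i} → i ∈ S → S ∋ i
  ∈⇒∋ = []=⇒lookup

  reach-preserves : ∀ i (P : Fin nV → Set)
    → (∀ d → edgeOf (proj₁ d) ≡ i → P (end d) → P (end (flipD d)))
    → ∀ {u w} → Reach G F i u w → P u → P w
  reach-preserves i P next here p = p
  reach-preserves i P next (step d e refl r) p = reach-preserves i P next r (next d e p)

  -- Induction along a member, starting at a common vertex with the anchor.
  spread : ∀ i (P : Fin nV → Set) → (∀ u → vert a u ≡ true → P u)
    → (∀ d → edgeOf (proj₁ d) ≡ i → P (end d) → P (end (flipD d)))
    → ∀ u → vert i u ≡ true → P u
  spread i P base next u iu = let v , av , iv = proj₂ cluster i in
    reach-preserves i P next (proj₁ cluster i v u iv iu) (base v av)

  root : Fin nV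
  root = proj₁ (proj₂ cluster a)

  root-in : vert a root ≡ true
  root-in = proj₁ (proj₂ (proj₂ cluster a))

  linked : ∀ S {W} → S ∋ a → W root ≡ true → Linked (edges S) (verts S) W
  linked S {W} Sa r W' W⊆W' closed u uS =
    let i , Si , iu = verts-elim S uS in spread i (λ u → W' u ≡ true) anchored (along i Si) u iu
    where
    along : ∀ i → S ∋ i → ∀ d → edgeOf (proj₁ d) ≡ i → W' (end d) ≡ true → W' (end (flipD d)) ≡ true
    along i Si d refl w = closed d Si w
    anchored : ∀ u → vert a u ≡ true → W' u ≡ true
    anchored u au = reach-preserves a (λ u → W' u ≡ true) (along a Sa)
      (proj₁ cluster a root u root-in au) (W⊆W' root r)

  -- Genus as the number of crossing edges.

  none : Edges
  none = const false

  rootOnly : Verts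
  rootOnly = insert root (const false)

  rootChain : ∀ S → S ∋ a → ∃[ q ] Chain (edges S) (verts S) none rootOnly q
  rootChain S Sa = chain (supported S) {none} {rootOnly} (λ d ()) (λ e ())
    (λ u w → [ (λ ()) , (λ { refl → verts-intro S a Sa root-in }) ]′ (insert-elim root (const false) {u} w))
    (linked S {rootOnly} Sa (insert-new root (const false)))

  rootReps : FaceReps none rootOnly (proj₁ (locate root) ∷ [])
  rootReps = record
    { sound = at-within i₀ at₀ (insert-new root (const false)) ∷ []
    ; separate = [] ∷ []
    ; complete = λ {i} w → i₀ , here refl , same i w }
    where
    i₀ = proj₁ (locate root)
    at₀ = proj₂ (locate root)
    same : ∀ i → Within rootOnly i → FaceEq none i₀ i
    same i w = let u , at , u∈ = within-at {rootOnly} i w in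
      at-same {none} (λ _ _ → refl) i₀ i at₀
        ([ (λ ()) , (λ e → subst (λ u → At u i) e at) ]′ (insert-elim root (const false) {u} u∈))

  V E Φ : Subset k → ℕ
  V S = Union.#V G F S
  E S = Union.#E G F S
  Φ S = Union.#F G F S

  -- A chain that starts from the root alone, with one vertex, one face and no edge, exhibits
  -- `2 + E S` minus `V S + Φ S` as `2 * q`. Hence the truncated subtraction and the division by 2
  -- in `genus` are exact.
  gen-euler : ∀ S → S ∋ a → 2 + E S ≡ V S + Φ S + 2 * gen G F S
  gen-euler S Sa = arith (E S) (V S + Φ S) q formula
    where
    q = proj₁ (rootChain S Sa)
    formula : E S + 2 ≡ V S + Φ S + 2 * q
    formula = trans (cong (λ n → E S + (n + 1)) (sym (trans (count-insert root (const false) refl) (cong suc (count-empty {nV})))))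
      (trans (euler {none} {rootOnly} (λ d ()) (proj₂ (rootChain S Sa)) rootReps (FaceCount.faceList-reps S))
      (trans (cong (_+ (V S + length (FaceCount.faceList S) + 2 * q)) (count-empty {nE}))
             (cong (λ n → V S + n + 2 * q) (FaceCount.faceList-length S))))
    arith : ∀ e s q → e + 2 ≡ s + 2 * q → 2 + e ≡ s + 2 * ((2 + e ∸ s) / 2)
    arith e s q eq = trans eq' (cong (λ n → s + 2 * n) (sym quotient))
      where
      eq' : 2 + e ≡ s + 2 * q
      eq' = trans (ℕₚ.+-comm 2 e) eq
      quotient : (2 + e ∸ s) / 2 ≡ q
      quotient = trans (cong (_/ 2) (trans (cong (_∸ s) eq') (trans (ℕₚ.m+n∸m≡n s (2 * q)) (ℕₚ.*-comm 2 q)))) (m*n/n≡m q 2)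

  _⊑_ : Subset k → Subset k → Set
  S ⊑ S' = ∀ {i} → S ∋ i → S' ∋ i

  -- Comparing the absolute Euler formulas of `S` and `S'` with the relative one identifies the
  -- number of crossing edges with the growth of the genus.
  memberChain : ∀ S S' → S ∋ a → S ⊑ S' → ∃[ q ] (Chain (edges S') (verts S') (edges S) (verts S) q × gen G F S' ≡ gen G F S + q)
  memberChain S S' Sa S⊑S' = q , c , sym (arith (E S) (V S + Φ S) (E S') (V S' + Φ S') q _ _ relative (gen-euler S Sa) (gen-euler S' (S⊑S' {a} Sa)))
    where
    qc : ∃[ q ] Chain (edges S') (verts S') (edges S) (verts S) q
    qc = chain (supported S') {edges S} {verts S} (supported S) (λ e → S⊑S' {edgeOf e})
      (λ u w → let i , Si , iu = verts-elim S w in verts-intro S' i (S⊑S' {i} Si) iu)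
      (linked S' {verts S} (S⊑S' {a} Sa) (verts-intro S a Sa root-in))
    q = proj₁ qc
    c = proj₂ qc
    relative : E S' + (V S + Φ S) ≡ E S + (V S' + Φ S' + 2 * q)
    relative = subst₂ (λ m n → E S' + (V S + m) ≡ E S + (V S' + n + 2 * q))
      (FaceCount.faceList-length S) (FaceCount.faceList-length S')
      (euler {edges S} {verts S} (supported S) c (FaceCount.faceList-reps S) (FaceCount.faceList-reps S'))
    arith : ∀ e s e' s' q g g' → e' + s ≡ e + (s' + 2 * q) → 2 + e ≡ s + 2 * g → 2 + e' ≡ s' + 2 * g' → g + q ≡ g'
    arith e s e' s' q g g' rel h h' = ℕₚ.*-cancelˡ-≡ (g + q) g' 2 (ℕₚ.+-cancelˡ-≡ (s + s') _ _ (begin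
      s + s' + 2 * (g + q)       ≡⟨ solve 4 (λ s s' g q → s :+ s' :+ con 2 :* (g :+ q) := s :+ con 2 :* g :+ (s' :+ con 2 :* q)) refl s s' g q ⟩
      s + 2 * g + (s' + 2 * q)   ≡⟨ cong (_+ (s' + 2 * q)) h ⟨
      2 + (e + (s' + 2 * q))     ≡⟨ cong (2 +_) rel ⟨
      2 + e' + s                 ≡⟨ cong (_+ s) h' ⟩
      s' + 2 * g' + s            ≡⟨ solve 3 (λ s s' g' → s' :+ con 2 :* g' :+ s := s :+ s' :+ con 2 :* g') refl s s' g' ⟩
      s + s' + 2 * g'            ∎))
      where
      open ≡-Reasoning
      open +-*-Solver

  -- The small families around the anchor, and gluing over them.

  A₀ : Subset k
  A₀ = ⁅ a ⁆

  A₂ : Fin k → Fin k → Subset k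
  A₂ p q = (A₀ ∪ ⁅ p ⁆) ∪ ⁅ q ⁆

  -- `p` and `q` serve the gluing of primitives, `i` and `j` the gluing of face colourings. Indices
  -- may coincide with each other or with `a`, so the size is only bounded above.
  A₄ : Fin k → Fin k → Fin k → Fin k → Subset k
  A₄ p q i j = (A₂ p q ∪ ⁅ i ⁆) ∪ ⁅ j ⁆

  A₄-size : ∀ p q i j → ∣ A₄ p q i j ∣ ≤ 5
  A₄-size p q i j = ∣∪⁅⁆∣≤ (A₂ p q ∪ ⁅ i ⁆) j (∣∪⁅⁆∣≤ (A₂ p q) i (∣∪⁅⁆∣≤ (A₀ ∪ ⁅ p ⁆) q (∣∪⁅⁆∣≤ A₀ p (ℕₚ.≤-reflexive (∣⁅x⁆∣≡1 a)))))

  ∪-left : ∀ S i → S ⊑ (S ∪ ⁅ i ⁆)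
  ∪-left S i {j} Sj = ∈⇒∋ {S ∪ ⁅ i ⁆} (x∈p∪q⁺ {p = S} (inj₁ (∋⇒∈ {S} Sj)))

  ∪-right : ∀ S i → (S ∪ ⁅ i ⁆) ∋ i
  ∪-right S i = ∈⇒∋ {S ∪ ⁅ i ⁆} (x∈p∪q⁺ {p = S} (inj₂ (x∈⁅x⁆ i)))

  A₀∋ : A₀ ∋ a
  A₀∋ = ∈⇒∋ {A₀} (x∈⁅x⁆ a)

  A₀⊑A₂ : ∀ p q → A₀ ⊑ A₂ p q
  A₀⊑A₂ p q {i} = ∪-left (A₀ ∪ ⁅ p ⁆) q {i} ∘ ∪-left A₀ p {i}

  A₂⊑A₄ : ∀ p q i j → A₂ p q ⊑ A₄ p q i j
  A₂⊑A₄ p q i j {m} = ∪-left (A₂ p q ∪ ⁅ i ⁆) j {m} ∘ ∪-left (A₂ p q) i {m}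

  A₂∋ˡ : ∀ p q → A₂ p q ∋ p
  A₂∋ˡ p q = ∪-left (A₀ ∪ ⁅ p ⁆) q {p} (∪-right A₀ p)

  A₂∋ʳ : ∀ p q → A₂ p q ∋ q
  A₂∋ʳ p q = ∪-right (A₀ ∪ ⁅ p ⁆) q

  A₂∋a : ∀ p q → A₂ p q ∋ a
  A₂∋a p q = A₀⊑A₂ p q {a} A₀∋

  -- Junk value a if no member contains u.
  home : Fin nV → Fin k
  home u = [ proj₁ , const a ]′ (toSum (Finₚ.any? (λ i → vert i u Boolₚ.≟ true)))

  home-in : ∀ {i} u → vert i u ≡ true → vert (home u) u ≡ true
  home-in {i} u iu = pick (toSum (Finₚ.any? (λ i → vert i u Boolₚ.≟ true)))
    where
    pick : (s : (∃[ i ] vert i u ≡ true) ⊎ (¬ (∃[ i ] vert i u ≡ true))) → vert ([ proj₁ , const a ]′ s) u ≡ true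
    pick (inj₁ (_ , e)) = e
    pick (inj₂ n)       = ⊥-elim (n (i , iu))

  Rooted : (Fin nE → Bool) → Subset k → Verts → Set
  Rooted x S v = (∀ u → verts A₀ u ≡ true → v u ≡ false) × Primitive (edges S) x v

  -- Both primitives are zero where member `i` meets the anchor, and along each edge of `i` the
  -- value at one end and `x` determine the value at the other.
  rooted-unique : ∀ x S S' v v' i → S ∋ i → S' ∋ i → Rooted x S v → Rooted x S' v'
    → ∀ u → vert i u ≡ true → v u ≡ v' u
  rooted-unique x S S' v v' i Si S'i (z , prim) (z' , prim') = spread i (λ u → v u ≡ v' u)
    (λ u au → let w = verts-intro A₀ a A₀∋ au in trans (z u w) (sym (z' u w))) next
    where
    value : ∀ v d → x (proj₁ d) ≡ δ v (proj₁ d) → v (end (flipD d)) ≡ v (end d) xor x (proj₁ d)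
    value v d e = xor-solve {v (end d)} (trans e (∂-dart (v ∘ end) d))
    next : ∀ d → edgeOf (proj₁ d) ≡ i → v (end d) ≡ v' (end d) → v (end (flipD d)) ≡ v' (end (flipD d))
    next d refl e = trans (value v d (prim (proj₁ d) Si))
      (trans (cong (_xor x (proj₁ d)) e) (sym (value v' d (prim' (proj₁ d) S'i))))

  -- At a vertex `u` of member `i`, the choice made through `home u` is compared with the choice for
  -- `i` by way of the family that contains both members. This comparison is what requires pairs.
  glue-rooted : ∀ x → (∀ i j → ∃[ v ] Rooted x (A₂ i j) v) → ∃[ v ] Rooted x ⊤ v
  glue-rooted x parts = v , (λ u w → proj₁ (good (home u) (home u)) u w) , λ e _ →
    let i = edgeOf e in trans (proj₂ (good i i) e (A₂∋ˡ i i))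
      (sym (cong₂ _xor_ (local i (end (e , false)) (end-in (e , false))) (local i (end (e , true)) (end-in (e , true)))))
    where
    part : Fin k → Fin k → Verts
    part i j = proj₁ (parts i j)
    good : ∀ i j → Rooted x (A₂ i j) (part i j)
    good i j = proj₂ (parts i j)
    v : Verts
    v u = part (home u) (home u) u
    local : ∀ i u → vert i u ≡ true → v u ≡ part i i u
    local i u iu = trans
      (rooted-unique x (A₂ h h) (A₂ h i) (part h h) (part h i) h (A₂∋ˡ h h) (A₂∋ˡ h i) (good h h) (good h i) u (home-in u iu))
      (rooted-unique x (A₂ h i) (A₂ i i) (part h i) (part i i) i (A₂∋ʳ h i) (A₂∋ˡ i i) (good h i) (good i i) u iu)
      where h = home u

  ExtendsOver : Subset k → (Dart nE → Bool) → Fin k → (Dart nE → Bool) → Set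
  ExtendsOver S f i g = Invariant (edges S) g × (∀ d → verts S (end d) ≡ true → g d ≡ f d)
    × (∀ d → edges S (proj₁ d) ≡ false → edgeOf (proj₁ d) ≡ i → g d ≡ g (flipD d))

  -- Agreement on all darts at one end of an edge of `i` passes to the other end. If that end lies
  -- in `S`, both extensions equal `f`. Otherwise `S` does not touch it, so its darts form one
  -- orbit, and flatness across the edge carries the value over.
  extension-unique : ∀ S f i g g' → S ∋ a → ExtendsOver S f i g → ExtendsOver S f i g'
    → ∀ u → vert i u ≡ true → ∀ d → end d ≡ u → g d ≡ g' d
  extension-unique S f i g g' Sa (inv-g , g≡f , fl) (inv-g' , g'≡f , fl') =
    spread i (λ u → ∀ d → end d ≡ u → g d ≡ g' d) base next
    where
    X = edges S
    W = verts S
    on-W : ∀ d → W (end d) ≡ true → g d ≡ g' d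
    on-W d w = trans (g≡f d w) (sym (g'≡f d w))
    base : ∀ u → vert a u ≡ true → ∀ d → end d ≡ u → g d ≡ g' d
    base u au d refl = on-W d (verts-intro S a Sa au)
    next : ∀ d → edgeOf (proj₁ d) ≡ i → (∀ d' → end d' ≡ end d → g d' ≡ g' d')
      → ∀ d' → end d' ≡ end (flipD d) → g d' ≡ g' d'
    next d i∋ same d' e = cases (W (end d')) refl
      where
      cases : ∀ b → W (end d') ≡ b → g d' ≡ g' d'
      cases true  w = on-W d' w
      cases false w = begin
        g d'           ≡⟨ invariant-orb {X} {g} inv-g close ⟨
        g (flipD d)    ≡⟨ fl d out i∋ ⟨
        g d            ≡⟨ same d refl ⟩
        g' d           ≡⟨ fl' d out i∋ ⟩
        g' (flipD d)   ≡⟨ invariant-orb {X} {g'} inv-g' close ⟩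
        g' d'          ∎
        where
        open ≡-Reasoning
        unt : Untouched X (end d')
        unt d″ e″ = Boolₚ.¬-not λ x → true≢false (trans (cong W (sym e″)) (supported S d″ x)) w
        out : X (proj₁ d) ≡ false
        out = unt (flipD d) (sym e)
        close : SameFace X (flipD d) d'
        close = untouched-same unt (flipD d) d' (sym e) refl

  -- Extend f over each pair of members i , j; on a single member the extension does not depend
  -- on the pair, so the extensions glue.
  glue-extensions : ∀ S f → S ∋ a → Invariant (edges S) f
    → (∀ i j → ∃[ g ] (ExtendsOver S f i g × ExtendsOver S f j g))
    → ∃[ g ] (Invariant (edges S) g × (∀ d → verts S (end d) ≡ true → g d ≡ f d)
             × (∀ i d → edges S (proj₁ d) ≡ false → edgeOf (proj₁ d) ≡ i → g d ≡ g (flipD d)))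
  glue-extensions S f Sa inv pieces = g , inv-g , g≡f , flat-g
    where
    X = edges S
    W = verts S
    piece : Fin k → Fin k → Dart nE → Bool
    piece i j = proj₁ (pieces i j)
    good : ∀ i j → ExtendsOver S f i (piece i j)
    good i j = proj₁ (proj₂ (pieces i j))
    local : ∀ i u → vert i u ≡ true → ∀ d → end d ≡ u → piece (home u) (home u) d ≡ piece i i d
    local i u iu d e = trans
      (extension-unique S f h (piece h h) (piece h i) Sa (good h h) (good h i) u (home-in u iu) d e)
      (extension-unique S f i (piece h i) (piece i i) Sa (proj₂ (proj₂ (pieces h i))) (good i i) u iu d e)
      where h = home u
    g : Dart nE → Bool
    g d = piece (home (end d)) (home (end d)) d
    g≡f : ∀ d → W (end d) ≡ true → g d ≡ f d
    g≡f d = proj₁ (proj₂ (good (home (end d)) (home (end d)))) d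
    inv-g : Invariant X g
    inv-g d = cases (X (proj₁ d)) refl
      where
      cases : ∀ b → X (proj₁ d) ≡ b → g (trace X d) ≡ g d
      cases true  x = trans (g≡f (trace X d)
          (supported-trace {X} {W} (supported S) {inj₁ d} (supported S d x)))
        (trans (inv d) (sym (g≡f d (supported S d x))))
      cases false x = trans
        (cong (λ u → piece (home u) (home u) (trace X d)) (trans (cong end (trace-out X x)) (rot-end d)))
        (proj₁ (good (home (end d)) (home (end d))) d)
    flat-g : ∀ i d → X (proj₁ d) ≡ false → edgeOf (proj₁ d) ≡ i → g d ≡ g (flipD d)
    flat-g i d x refl = trans (local i (end d) (end-in d) d refl)
      (trans (proj₂ (proj₂ (good i i)) d x refl)
             (sym (local i (end (flipD d)) (end-in (flipD d)) (flipD d) refl)))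

  -- The contradiction when no small family raises the genus.

  module Stable (stable : ∀ p q i j → gen G F (A₄ p q i j) ≤ gen G F A₀) where

    no-excess : ∀ {g₀ g₂ g₄} m n → g₂ ≡ g₀ + m → g₄ ≡ g₂ + n → g₄ ≤ g₀ → m ≡ 0 × n ≡ 0
    no-excess {g₀} m n refl refl le = ℕₚ.m+n≡0⇒m≡0 m sum≡0 , ℕₚ.m+n≡0⇒n≡0 m sum≡0
      where
      sum≡0 : m + n ≡ 0
      sum≡0 = ℕₚ.n≤0⇒n≡0 (ℕₚ.+-cancelˡ-≤ g₀ _ _
        (subst₂ _≤_ (ℕₚ.+-assoc g₀ m n) (sym (ℕₚ.+-identityʳ g₀)) le))

    chains : ∀ p q i j → Chain (edges (A₂ p q)) (verts (A₂ p q)) (edges A₀) (verts A₀) 0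
      × Chain (edges (A₄ p q i j)) (verts (A₄ p q i j)) (edges (A₂ p q)) (verts (A₂ p q)) 0
    chains p q i j = rigid (memberChain A₀ (A₂ p q) A₀∋ (A₀⊑A₂ p q)) (memberChain (A₂ p q) (A₄ p q i j) (A₂∋a p q) (A₂⊑A₄ p q i j)) (stable p q i j)
      where
      rigid : ∀ {Y Z Y' Z' X W g₀ g₂ g₄} → ∃[ m ] (Chain Y Z X W m × g₂ ≡ g₀ + m)
        → ∃[ n ] (Chain Y' Z' Y Z n × g₄ ≡ g₂ + n) → g₄ ≤ g₀ → Chain Y Z X W 0 × Chain Y' Z' Y Z 0
      rigid {Y} {Z} {Y'} {Z'} {X} {W} (m , c , e) (n , c' , e') le =
        let m≡0 , n≡0 = no-excess m n e e' le
        in subst (Chain Y Z X W) m≡0 c , subst (Chain Y' Z' Y Z) n≡0 c'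

    inner : ∀ p q → Chain (edges (A₂ p q)) (verts (A₂ p q)) (edges A₀) (verts A₀) 0
    -- The second pair is a filler: only the part of the chain up to `A₂ p q` is kept.
    inner p q = proj₁ (chains p q p q)

    outer : ∀ p q i j → Chain (edges (A₄ p q i j)) (verts (A₄ p q i j)) (edges (A₂ p q)) (verts (A₂ p q)) 0
    outer p q i j = proj₂ (chains p q i j)

    -- Here the families of five enter: the colouring extends over any two further members at once,
    -- because the chain from `A₂ p q` to `A₄ p q i j` has no crossing edge, and these extensions
    -- glue.
    extends-all : ∀ p q → Extends (edges (A₂ p q)) (verts (A₂ p q)) (edges ⊤)
    extends-all p q f inv =
      let g , inv-g , g≡f , flat = glue-extensions (A₂ p q) f (A₂∋a p q) inv pieces
      in g , inv-g , g≡f , λ d x _ → flat (edgeOf (proj₁ d)) d x refl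
      where
      X = edges (A₂ p q)
      W = verts (A₂ p q)
      pieces : ∀ i j → ∃[ g ] (ExtendsOver (A₂ p q) f i g × ExtendsOver (A₂ p q) f j g)
      pieces i j =
        let g , inv-g , g≡f , flat = chain-extends {X} {W} (supported (A₂ p q)) (outer p q i j) f inv
        in g , (inv-g , g≡f , λ { d x refl → flat d x (∪-left (A₂ p q ∪ ⁅ i ⁆) j {i} (∪-right (A₂ p q) i)) })
             , (inv-g , g≡f , λ { d x refl → flat d x (∪-right (A₂ p q ∪ ⁅ i ⁆) j) })

    parts : ∀ x → Closed (edges ⊤) x → (∀ e → edges A₀ e ≡ true → x e ≡ false) → ∀ i j → ∃[ v ] Rooted x (A₂ i j) v
    parts x cl zero-x i j =
      -- As `x` vanishes on the anchor, the zero function is a primitive there; extended along the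
      -- chain to `A₂ i j`, it stays zero on the anchor.
      let v , prim , agree = chain-primitive {edges A₀} {verts A₀} {x = x} {v = const false} (supported A₀) (inner i j)
            (closed-restrict {edges (A₂ i j)} {verts (A₂ i j)} {x = x} (supported (A₂ i j)) (λ e _ → ∈⇒∋ {⊤} ∈⊤) (extends-all i j) cl)
            zero-x
      in v , agree , prim

    contradiction : ¬ gen G F A₀ < gen G F ⊤
    contradiction lt = go (memberChain A₀ ⊤ A₀∋ (λ _ → ∈⇒∋ {⊤} ∈⊤))
      where
      go : ∃[ q ] (Chain (edges ⊤) (verts ⊤) (edges A₀) (verts A₀) q × gen G F ⊤ ≡ gen G F A₀ + q) → ⊥
      go (zero  , c , e) = ℕₚ.<-irrefl (sym (trans e (ℕₚ.+-identityʳ _))) lt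
      go (suc q , c , e) =
        let x , cl , zero-x , no-v = obstruction {edges A₀} {verts A₀} (supported A₀) c
            v , zero-v , prim = glue-rooted x (parts x cl zero-x)
        in no-v v zero-v prim

  bounded-witness : gen G F A₀ < gen G F ⊤ → ∃[ S ] (a ∈ S × ∣ S ∣ ≤ 5 × gen G F A₀ < gen G F S)
  -- The search over four indices is finite, so refuting the absence of a witness yields one
  -- constructively.
  bounded-witness lt = decide (Finₚ.any? λ p → Finₚ.any? λ q → Finₚ.any? λ i → Finₚ.any? λ j →
    gen G F A₀ <? gen G F (A₄ p q i j))
    where
    decide : Dec (∃[ p ] ∃[ q ] ∃[ i ] ∃[ j ] gen G F A₀ < gen G F (A₄ p q i j))
      → ∃[ S ] (a ∈ S × ∣ S ∣ ≤ 5 × gen G F A₀ < gen G F S)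
    decide (yes (p , q , i , j , bigger)) =
      A₄ p q i j , ∋⇒∈ {A₄ p q i j} (A₂⊑A₄ p q i j {a} (A₂∋a p q)) , A₄-size p q i j , bigger
    decide (no none) = ⊥-elim (Stable.contradiction
      (λ p q i j → ℕₚ.≮⇒≥ (λ bigger → none (p , q , i , j , bigger))) lt)

theorem2 : (G : EmbeddedGraph) (k : ℕ) (F : Family G k) (a : Fin k)
    → IsCluster G F a
    → gen G F ⁅ a ⁆ < gen G F ⊤
    → ∃[ S ] (a ∈ S × ∣ S ∣ ≤ 5 × gen G F ⁅ a ⁆ < gen G F S)
theorem2 G k F a cluster = Cluster.bounded-witness G F a cluster
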